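{- Let $H$ be a bipartite graph with $v$ vertices and $e$ edges, where $v\le e$. Set $s:=\frac{2e}{v}$ and $s':=\frac{2e}{2e-v}$. Assume that for every nonnegative symmetric matrix $W$, $$\hom(H,W)\ge \|W\|_{s'\to s}^{\,e}.$$ Let $\operatorname{sub}(H)$ be the graph obtained by subdividing every edge of $H$ once. Then $\operatorname{sub}(H)$ satisfies the operator-norm Sidorenko certificate. More precisely, for every graph $G$ with adjacency matrix $A=A(G)$, $$\hom(\operatorname{sub}(H),G)\ge \|A\|_{\sigma'\to\sigma}^{\,2e},\qquad\text{where } \sigma=\frac{4e}{v+e},\quad \sigma'=\frac{4e}{3e-v}.$$
   Context: Graphs are finite and simple, with nonempty vertex set. $\hom(H,G)$ is the number of homomorphisms from $H$ to $G$. For an entrywise nonnegative real symmetric matrix $W=(w_{ij})_{i,j\in[n]}$, $\hom(H,W):=\sum_{\phi:V(H)\to[n]}\prod_{uv\in E(H)}w_{\phi(u)\phi(v)}$. For a real $n\times n$ matrix $A$ and $1\le p,r\le\infty$, $\|A\|_{p\to r}:=\sup_{x\ne0}\|Ax\|_r/\|x\|_p$, with the usual $\ell^p$ norms on $\mathbb R^n$. Operator-norm Sidorenko certificate: a bipartite graph $F$ with $v_F$ vertices and $e_F$ edges, $v_F\le e_F$, satisfies it if for every graph $G$ with adjacency matrix $A$, $\hom(F,G)\ge\|A\|_{s_F'\to s_F}^{e_F}$, where $s_F=\frac{2e_F}{v_F}$ and $s_F'=\frac{2e_F}{2e_F-v_F}$. -}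

module Defs where

open import Level using (0ℓ)
open import Algebra.Bundles using (CommutativeRing; Semiring)
open import Algebra.Structures using (IsCommutativeRing)
import Algebra.Definitions.RawSemiring
open import Data.Bool.Base using (Bool; if_then_else_)
open import Data.Empty using (⊥)
open import Data.Fin.Base using (Fin; finToFun; splitAt)
open import Data.Fin.Properties using (all?; _≟_; _<?_)
open import Data.Integer.Base using (+_; ∣_∣)
open import Data.List.Base using (List; allFin; cartesianProduct; filter; length; lookup)
open import Data.Nat.Base as ℕ using (ℕ; NonZero; _∸_)
import Data.Nat.Properties as ℕ
open import Data.Product.Base using (∃; _×_; _,_; proj₁; proj₂)
open import Data.Rational.Unnormalised.Base as ℚ using (ℚᵘ; ↥_; ↧ₙ_; 1/_)
open import Data.Rational.Unnormalised.Properties using (pos⇒nonZero; 1/pos⇒pos)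
open import Data.Sum.Base using (_⊎_; inj₁; inj₂)
open import Data.Vec.Functional using (Vector)
open import Function.Base using (_on_)
open import Relation.Binary.Core using (Rel)
open import Relation.Binary.Definitions using (Decidable; Symmetric; Irreflexive)
open import Relation.Binary.PropositionalEquality.Core using (_≡_; _≢_; refl)
open import Relation.Binary.Structures using (IsDecTotalOrder)
open import Relation.Nullary using (Dec; no; does; ¬_; _×-dec_; _⊎-dec_; _→-dec_)

-- The (classical) real line, as a Dedekind-complete ordered field; this
-- determines it up to isomorphism.  As `sup` is a total operation, its
-- value is left unspecified on empty and on unbounded predicates.
record Reals : Set₁ where
  infixl 6 _+_
  infixl 7 _*_
  infix  4 _≤_
  infix  8 -_
  infix  9 _⁻¹
  field
    ℝ                 : Set
    _+_ _*_           : ℝ → ℝ → ℝ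
    -_                : ℝ → ℝ
    0ℝ 1ℝ             : ℝ
    isCommutativeRing : IsCommutativeRing _≡_ _+_ _*_ -_ 0ℝ 1ℝ
    0≢1               : 0ℝ ≢ 1ℝ
    _⁻¹               : ℝ → ℝ
    *-inverseʳ        : ∀ x → x ≢ 0ℝ → x * x ⁻¹ ≡ 1ℝ

    _≤_               : Rel ℝ 0ℓ
    isDecTotalOrder   : IsDecTotalOrder _≡_ _≤_
    +-monoˡ-≤         : ∀ z {x y} → x ≤ y → x + z ≤ y + z
    *-nonNeg          : ∀ {x y} → 0ℝ ≤ x → 0ℝ ≤ y → 0ℝ ≤ x * y

  IsUpperBound : (ℝ → Set) → ℝ → Set
  IsUpperBound P b = ∀ x → P x → x ≤ b

  field
    sup       : (ℝ → Set) → ℝ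
    sup-upper : ∀ P → ∃ P → ∃ (IsUpperBound P) → IsUpperBound P (sup P)
    sup-least : ∀ P → ∃ P → ∀ b → IsUpperBound P b → sup P ≤ b

  commutativeRing : CommutativeRing 0ℓ 0ℓ
  commutativeRing = record { isCommutativeRing = isCommutativeRing }

  open CommutativeRing commutativeRing using (semiring)
  open IsDecTotalOrder isDecTotalOrder public using (_≤?_)
  open Algebra.Definitions.RawSemiring (Semiring.rawSemiring semiring) public
    using (_^_; sum; product) renaming (_×_ to _·_)

  infixl 7 _÷_
  _÷_ : ℝ → ℝ → ℝ
  x ÷ y = x * y ⁻¹

  abs : ℝ → ℝ
  abs x = if does (0ℝ ≤? x) then x else - x

  fromℕ : ℕ → ℝ
  fromℕ n = n · 1ℝ

record Exponent : Set where
  constructor exponent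
  field
    value        : ℚᵘ
    {{positive}} : ℚ.Positive value

open Exponent public

recip : Exponent → Exponent
recip (exponent p) = exponent (1/ p) {{1/pos⇒pos p}}
  where instance _ = pos⇒nonZero p

ratio : (a b : ℕ) → .{{NonZero a}} → .{{NonZero b}} → Exponent
ratio a b = exponent ((+ a) ℚ./ b) {{/-positive a b}}
  where
  /-positive : ∀ a b → .{{_ : NonZero a}} → .{{_ : NonZero b}} →
               ℚ.Positive ((+ a) ℚ./ b)
  /-positive (ℕ.suc _) (ℕ.suc _) = _

-- The four exponents as functions of the numbers v of vertices and e of
-- edges.  The subtractions are not truncated, because v ≤ e.
module _ (v e : ℕ) {{_ : NonZero v}} (v≤e : v ℕ.≤ e) where
  private
    0<v : 0 ℕ.< v
    0<v = ℕ.>-nonZero⁻¹ v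

    0<e : 0 ℕ.< e
    0<e = ℕ.<-≤-trans 0<v v≤e

    v<ke : ∀ k → v ℕ.< ℕ.suc (ℕ.suc k) ℕ.* e
    v<ke k = ℕ.<-≤-trans (ℕ.≤-<-trans v≤e (ℕ.m<m+n e 0<e))
                         (ℕ.+-monoʳ-≤ e (ℕ.m≤m+n e (k ℕ.* e)))

    ke≢0 : ∀ k → NonZero (ℕ.suc k ℕ.* e)
    ke≢0 k = ℕ.m*n≢0 (ℕ.suc k) e {{_}} {{ℕ.>-nonZero 0<e}}

    ke∸v≢0 : ∀ k → NonZero (ℕ.suc (ℕ.suc k) ℕ.* e ∸ v)
    ke∸v≢0 k = ℕ.>-nonZero (ℕ.m<n⇒0<n∸m (v<ke k))

    v+e≢0 : NonZero (v ℕ.+ e)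
    v+e≢0 = ℕ.>-nonZero (ℕ.<-≤-trans 0<v (ℕ.m≤m+n v e))

  s s′ σ σ′ : Exponent
  s  = ratio (2 ℕ.* e) v {{ke≢0 1}}
  s′ = ratio (2 ℕ.* e) (2 ℕ.* e ∸ v) {{ke≢0 1}} {{ke∸v≢0 0}}
  σ  = ratio (4 ℕ.* e) (v ℕ.+ e) {{ke≢0 3}} {{v+e≢0}}
  σ′ = ratio (4 ℕ.* e) (3 ℕ.* e ∸ v) {{ke≢0 3}} {{ke∸v≢0 1}}

record Graph : Set₁ where
  field
    order       : ℕ
    {{order≢0}} : NonZero order
    Adj         : Rel (Fin order) 0ℓ
    Adj?        : Decidable Adj
    symmetric   : Symmetric Adj
    loopless    : Irreflexive _≡_ Adj

  Vertex : Set
  Vertex = Fin order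

  -- Each edge is listed once, with its smaller endpoint first.
  edges : List (Vertex × Vertex)
  edges = filter (λ (i , j) → (i <? j) ×-dec Adj? i j)
                 (cartesianProduct (allFin order) (allFin order))

  size : ℕ
  size = length edges

  endpoints : Fin size → Vertex × Vertex
  endpoints = lookup edges

open Graph public

Bipartite : Graph → Set
Bipartite G = ∃ λ (colour : Vertex G → Bool) →
  ∀ {i j} → Adj G i j → colour i ≢ colour j

module Subdivision (H : Graph) where
  Node : Set
  Node = Vertex H ⊎ Fin (size H)

  _endpointOf_ : Vertex H → Fin (size H) → Set
  u endpointOf k = u ≡ proj₁ (endpoints H k) ⊎ u ≡ proj₂ (endpoints H k)

  endpointOf? : Decidable _endpointOf_
  endpointOf? u k =
    (u ≟ proj₁ (endpoints H k)) ⊎-dec (u ≟ proj₂ (endpoints H k))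

  Incident : Rel Node 0ℓ
  Incident (inj₁ u) (inj₁ _) = ⊥
  Incident (inj₁ u) (inj₂ k) = u endpointOf k
  Incident (inj₂ k) (inj₁ u) = u endpointOf k
  Incident (inj₂ _) (inj₂ _) = ⊥

  incident? : Decidable Incident
  incident? (inj₁ _) (inj₁ _) = no λ ()
  incident? (inj₁ u) (inj₂ k) = endpointOf? u k
  incident? (inj₂ k) (inj₁ u) = endpointOf? u k
  incident? (inj₂ _) (inj₂ _) = no λ ()

  incident-sym : ∀ x y → Incident x y → Incident y x
  incident-sym (inj₁ _) (inj₂ _) p = p
  incident-sym (inj₂ _) (inj₁ _) p = p

  incident-irrefl : ∀ x → ¬ Incident x x
  incident-irrefl (inj₁ _) ()
  incident-irrefl (inj₂ _) ()

-- The first `order H` vertices of `sub H` are those of H, and the other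
-- `size H` vertices subdivide the edges of H.
sub : Graph → Graph
sub H = record
  { order     = order H ℕ.+ size H
  ; order≢0   = ℕ.>-nonZero
      (ℕ.<-≤-trans (ℕ.>-nonZero⁻¹ (order H)) (ℕ.m≤m+n (order H) (size H)))
  ; Adj       = Incident on splitAt (order H)
  ; Adj?      = λ i j → incident? (splitAt (order H) i) (splitAt (order H) j)
  ; symmetric = λ {i} {j} →
      incident-sym (splitAt (order H) i) (splitAt (order H) j)
  ; loopless  = λ { {i} refl → incident-irrefl (splitAt (order H) i) }
  }
  where open Subdivision H

IsHom : (H G : Graph) → (Vertex H → Vertex G) → Set
IsHom H G φ = ∀ i j → Adj H i j → Adj G (φ i) (φ j)

isHom? : ∀ H G φ → Dec (IsHom H G φ)
isHom? H G φ = all? λ i → all? λ j → Adj? H i j →-dec Adj? G (φ i) (φ j)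

-- `finToFun` is a bijection from Fin (n ^ k) to the maps Fin k → Fin n.
hom : Graph → Graph → ℕ
hom H G = length (filter (λ c → isHom? H G (finToFun c))
                         (allFin (order G ℕ.^ order H)))

open Reals {{...}} public

module _ {{R : Reals}} where

  Matrix : ℕ → Set
  Matrix n = Fin n → Fin n → ℝ

  NonNegative : ∀ {n} → Matrix n → Set
  NonNegative W = ∀ i j → 0ℝ ≤ W i j

  SymmetricMatrix : ∀ {n} → Matrix n → Set
  SymmetricMatrix W = ∀ i j → W i j ≡ W j i

  homW : ∀ {n} → Graph → Matrix n → ℝ
  homW {n} H W = sum {n ℕ.^ order H} λ c → product {size H} λ k →
    let (u , v) = endpoints H k
    in W (finToFun c u) (finToFun c v)

  adjacency : (G : Graph) → Matrix (order G)
  adjacency G i j = if does (Adj? G i j) then 1ℝ else 0ℝ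

  -- For 0 ≤ x and 1 ≤ n, this is the non-negative n-th root of x.
  root : ℕ → ℝ → ℝ
  root n x = sup λ y → 0ℝ ≤ y × y ^ n ≤ x

  -- Real powers x ^ (a / b) = (x ^ a) ^ (1 / b), meant for 0 ≤ x.
  pow : ℝ → Exponent → ℝ
  pow x p = root (↧ₙ value p) (x ^ ∣ ↥ value p ∣)

  ∥_∥[_] : ∀ {n} → Vector ℝ n → Exponent → ℝ
  ∥ x ∥[ p ] = pow (sum λ i → pow (abs (x i)) p) (recip p)

  apply : ∀ {n} → Matrix n → Vector ℝ n → Vector ℝ n
  apply A x i = sum λ j → A i j * x j

  opNorm : ∀ {n} → Matrix n → (p r : Exponent) → ℝ
  opNorm {n} A p r = sup λ t → ∃ λ (x : Vector ℝ n) →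
    ¬ (∀ i → x i ≡ 0ℝ) × t ≡ ∥ apply A x ∥[ r ] ÷ ∥ x ∥[ p ]

  Certificate : Graph → Set₁
  Certificate F = Bipartite F × ∃ λ (v≤e : order F ℕ.≤ size F) →
    (G : Graph) →
    opNorm (adjacency G) (s′ (order F) (size F) v≤e) (s (order F) (size F) v≤e)
      ^ size F ≤ fromℕ (hom F G)

{-# OPTIONS --safe #-}

-- Let A be the adjacency matrix of G and W = A².  Summing over the images of
-- the subdividing vertices gives hom(sub H, G) = hom(H, W), so it is enough
-- that ‖A‖_{σ′→σ}² ≤ ‖W‖_{s′→s}.  Write K for the right-hand side.  By Hölder
-- ⟨u, W u⟩ ≤ K ‖u‖²_{s′}, that is ‖A u‖₂² ≤ K ‖u‖²_{s′}, hence
-- ⟨u, A w⟩² ≤ K ‖u‖²_{s′} ‖w‖₂².  As A is nonnegative and 1/σ′ is the mean of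
-- 1/s′ and 1/2, Cauchy–Schwarz with the weights A i j interpolates between
-- this bound and its transpose:  ⟨y, A x⟩ ≤ √K ‖y‖_{σ′} ‖x‖_{σ′}.  Taking
-- y = (A x)^{σ−1} gives ‖A x‖_σ ≤ √K ‖x‖_{σ′}.
--
-- All exponents being rational, the vectors are written as integer powers of
-- roots, and every norm inequality as one between integer powers of sums.

module Submission where

open import Defs
  using (Reals; module Reals; Exponent; ratio; recip; s; s′; σ; σ′;
         Graph; order; order≢0; size; endpoints; Adj; Adj?; symmetric; Bipartite;
         module Subdivision; sub; IsHom; isHom?; hom; Matrix; NonNegative; SymmetricMatrix;
         homW; adjacency; root; pow; ∥_∥[_]; apply; opNorm; Certificate)
open import Level using (0ℓ)
open import Algebra.Bundles using (CommutativeRing; Monoid; Semiring)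
import Algebra.Properties.AbelianGroup
import Algebra.Properties.CommutativeSemiring.Exp
import Algebra.Properties.Monoid.Mult
import Algebra.Properties.Monoid.Sum
import Algebra.Properties.Ring
import Algebra.Properties.Semiring.Sum
import Algebra.Solver.Ring.NaturalCoefficients.Default
open import Data.Bool.Base using (Bool; true; false; if_then_else_)
open import Data.Fin.Base using (Fin; zero; suc; combine; finToFun; splitAt; toℕ; _↑ˡ_; _↑ʳ_)
open import Data.Fin.Properties
  using (all?; ¬∀⟶∃¬; _≟_; _<?_; toℕ<n; toℕ-↑ˡ; toℕ-↑ʳ; splitAt-↑ˡ; splitAt⁻¹-↑ˡ; splitAt-↑ʳ;
         remQuot-combine)
open import Data.List.Base using (allFin; cartesianProduct; filter; length; map; tabulate; _++_)
open import Data.List.Membership.Propositional.Properties using (∈-filter⁻; ∈-lookup)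
open import Data.List.Properties using (filter-++; length-++)
open import Data.Nat.Base as ℕ using (ℕ; zero; suc; NonZero; _∸_)
import Data.Nat.Properties as ℕ
open import Data.Nat.Tactic.RingSolver using (solve-∀)
open import Data.Product.Base using (∃; _×_; _,_; proj₁; proj₂)
open import Data.Sum.Base using (inj₁; inj₂; [_,_])
open import Data.Vec.Functional using (Vector; _∷_)
open import Function.Base using (_∘_; id; it)
open import Function.Bundles using (_⇔_; mk⇔)
open import Relation.Binary.Bundles using (DecTotalOrder)
open import Relation.Binary.PropositionalEquality
  using (_≡_; _≢_; _≗_; refl; sym; trans; cong; cong₂; subst; subst₂; module ≡-Reasoning)
import Relation.Binary.Reasoning.PartialOrder
open import Relation.Nullary using (¬_; Dec; yes; no; does; contradiction; _×-dec_)
open import Relation.Nullary.Decidable using (dec-true; dec-false; does-⇔)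
open import Relation.Unary using (Pred; Decidable)

-- The hypothesis is applied to A², which in general has entries above 1 and a nonzero diagonal;
-- this is where its validity for weighted matrices enters. Put m = 2e - v, k = v and N = m + k =
-- 2e. A vector measured in ℓ^{N/m} is written `a i ^ m`, so the N-th power of its norm is (Σ aᴺ)^m;
-- likewise for N / k = s and for N / e = 2. All three norms thus become powers of one and the same
-- kind of sum, and the bound and its transpose combine by multiplying powers of two numbers, Σ aᴺ
-- and Σ bᴺ. The price is that common powers are cancelled, so every vanishing sum has to be treated
-- apart. A second obstacle is that `sup` says nothing about unbounded predicates: an operator norm
-- bounds a quotient only after some finite bound, however crude, is known.

+-nonZero : ∀ a b .{{_ : NonZero a}} → NonZero (a ℕ.+ b)
+-nonZero (suc a) b = _

-- An `Exponent` holds an unreduced fraction, so two exponents of equal value are equal only if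
-- numerators and denominators agree separately. All later exponents are chosen with this in mind.
ratio-cong : ∀ {a b a′ b′} .{{_ : NonZero a}} .{{_ : NonZero b}} (p : a ≡ a′) (q : b ≡ b′) →
             ratio a b ≡ ratio a′ b′ {{subst NonZero p it}} {{subst NonZero q it}}
ratio-cong refl refl = refl

-- Counting the edges of the subdivision

module ℕΣ = Algebra.Properties.Semiring.Sum ℕ.+-*-semiring

-- Stated for a monoid because it serves both the edge count in ℕ and the sums over maps in ℝ.
module SumSplit {a ℓ} (M : Monoid a ℓ) where
  open Monoid M renaming (refl to ≈-refl; sym to ≈-sym; trans to ≈-trans)
  open Algebra.Properties.Monoid.Sum M using (sum)

  sum-↑ : ∀ m {n} (f : Vector Carrier (m ℕ.+ n)) →
          sum f ≈ sum (f ∘ (_↑ˡ n)) ∙ sum (f ∘ (m ↑ʳ_))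
  sum-↑ zero    f = ≈-sym (identityˡ _)
  sum-↑ (suc m) f = ≈-trans (∙-congˡ (sum-↑ m (f ∘ suc))) (≈-sym (assoc _ _ _))

  sum-combine : ∀ m {n} (f : Vector Carrier (m ℕ.* n)) →
                sum f ≈ sum λ i → sum λ j → f (combine {m} i j)
  sum-combine zero        f = ≈-refl
  sum-combine (suc m) {n} f = ≈-trans (sum-↑ n f) (∙-congˡ (sum-combine m (f ∘ (n ↑ʳ_))))

𝟙 : Bool → ℕ
𝟙 b = if b then 1 else 0

module _ {A : Set} {P : Pred A 0ℓ} (P? : Decidable P) where
  length-filter-tabulate : ∀ {n} (f : Fin n → A) →
    length (filter P? (tabulate f)) ≡ ℕΣ.sum λ i → 𝟙 (does (P? (f i)))
  length-filter-tabulate {zero}  f = refl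
  length-filter-tabulate {suc n} f with does (P? (f zero))
  ... | true  = cong suc (length-filter-tabulate (f ∘ suc))
  ... | false = length-filter-tabulate (f ∘ suc)

module _ {A B : Set} {P : Pred (A × B) 0ℓ} (P? : Decidable P) where
  private
    length-filter-map-tabulate : ∀ a {n} (g : Fin n → B) →
      length (filter P? (map (a ,_) (tabulate g))) ≡ ℕΣ.sum λ j → 𝟙 (does (P? (a , g j)))
    length-filter-map-tabulate a {zero}  g = refl
    length-filter-map-tabulate a {suc n} g with does (P? (a , g zero))
    ... | true  = cong suc (length-filter-map-tabulate a (g ∘ suc))
    ... | false = length-filter-map-tabulate a (g ∘ suc)

  length-filter-cartesianProduct : ∀ {m n} (f : Fin m → A) (g : Fin n → B) →
    length (filter P? (cartesianProduct (tabulate f) (tabulate g))) ≡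
    ℕΣ.sum λ i → ℕΣ.sum λ j → 𝟙 (does (P? (f i , g j)))
  length-filter-cartesianProduct {zero}  f g = refl
  length-filter-cartesianProduct {suc m} f g = begin
    length (filter P? (map (f zero ,_) (tabulate g) ++ rest))
      ≡⟨ cong length (filter-++ P? (map (f zero ,_) (tabulate g)) rest) ⟩
    length (filter P? (map (f zero ,_) (tabulate g)) ++ filter P? rest)
      ≡⟨ length-++ (filter P? (map (f zero ,_) (tabulate g))) ⟩
    length (filter P? (map (f zero ,_) (tabulate g))) ℕ.+ length (filter P? rest)
      ≡⟨ cong₂ ℕ._+_ (length-filter-map-tabulate (f zero) g) (length-filter-cartesianProduct (f ∘ suc) g) ⟩
    ℕΣ.sum (λ i → ℕΣ.sum λ j → 𝟙 (does (P? (f i , g j)))) ∎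
    where
    open ≡-Reasoning
    rest = cartesianProduct (tabulate (f ∘ suc)) (tabulate g)

endpoints-< : ∀ H k → toℕ (proj₁ (endpoints H k)) ℕ.< toℕ (proj₂ (endpoints H k))
endpoints-< H k = proj₁ (proj₂ (∈-filter⁻ (λ (i , j) → (i <? j) ×-dec Adj? H i j)
  {xs = cartesianProduct (allFin (order H)) (allFin (order H))} (∈-lookup k)))

endpoints-≢ : ∀ H k → proj₁ (endpoints H k) ≢ proj₂ (endpoints H k)
endpoints-≢ H k eq = ℕ.<⇒≢ (endpoints-< H k) (cong toℕ eq)

sum-≟ : ∀ {n} (a : Fin n) → ℕΣ.sum (λ i → 𝟙 (does (i ≟ a))) ≡ 1
sum-≟ {suc n} zero    = cong suc (ℕΣ.sum-replicate-zero n)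
sum-≟ {suc n} (suc a) = sum-≟ a

module _ (H : Graph) where
  open Subdivision H
  private
    v = order H
    e = size H

    isEdge? : ∀ i j → Dec (toℕ i ℕ.< toℕ j × Adj (sub H) i j)
    isEdge? i j = (i <? j) ×-dec Adj? (sub H) i j

    𝟙-no : ∀ {A : Set} (d : Dec A) → ¬ A → 𝟙 (does d) ≡ 0
    𝟙-no d ¬a = cong 𝟙 (dec-false d ¬a)

    vertex-vertex : ∀ i i′ → 𝟙 (does (isEdge? (i ↑ˡ e) (i′ ↑ˡ e))) ≡ 0
    vertex-vertex i i′ = 𝟙-no (isEdge? (i ↑ˡ e) (i′ ↑ˡ e)) λ (_ , adj) →
      subst₂ Incident (splitAt-↑ˡ v i e) (splitAt-↑ˡ v i′ e) adj

    -- Subdividing vertices come after all vertices of H, so one of them could be the smaller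
    -- endpoint only towards another subdividing vertex, and no two of these are adjacent.
    edge-any : ∀ k j → 𝟙 (does (isEdge? (v ↑ʳ k) j)) ≡ 0
    edge-any k j = 𝟙-no (isEdge? (v ↑ʳ k) j) λ (k<j , adj) → impossible j k<j
      (subst (λ x → Incident x (splitAt v j)) (splitAt-↑ʳ v e k) adj)
      where
      impossible : ∀ j → toℕ (v ↑ʳ k) ℕ.< toℕ j → ¬ Incident (inj₂ k) (splitAt v j)
      impossible j k<j inc with splitAt v j in eq
      ... | inj₁ i = ℕ.<-irrefl refl (ℕ.<-≤-trans (toℕ<n i)
        (ℕ.≤-trans (ℕ.m≤m+n v (toℕ k)) (ℕ.<⇒≤ (subst₂ ℕ._<_ (toℕ-↑ʳ v k)
          (trans (cong toℕ (sym (splitAt⁻¹-↑ˡ eq))) (toℕ-↑ˡ i e)) k<j))))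

    vertex-edge : ∀ i k → does (isEdge? (i ↑ˡ e) (v ↑ʳ k)) ≡ does (endpointOf? i k)
    vertex-edge i k = does-⇔ (mk⇔
      (λ (_ , adj) → subst₂ Incident (splitAt-↑ˡ v i e) (splitAt-↑ʳ v e k) adj)
      (λ inc → subst₂ ℕ._<_ (sym (toℕ-↑ˡ i e)) (sym (toℕ-↑ʳ v k))
                 (ℕ.<-≤-trans (toℕ<n i) (ℕ.m≤m+n v (toℕ k))) ,
               subst₂ Incident (sym (splitAt-↑ˡ v i e)) (sym (splitAt-↑ʳ v e k)) inc))
      (isEdge? (i ↑ˡ e) (v ↑ʳ k)) (endpointOf? i k)

    -- The indicator of the disjunction splits into a sum because the endpoints of a listed edge are
    -- distinct, being strictly ordered.
    two-endpoints : ∀ k → ℕΣ.sum (λ i → 𝟙 (does (endpointOf? i k))) ≡ 2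
    two-endpoints k = begin
      ℕΣ.sum (λ i → 𝟙 (does (endpointOf? i k)))
        ≡⟨ ℕΣ.sum-cong-≗ disjoint ⟩
      ℕΣ.sum (λ i → 𝟙 (does (i ≟ a)) ℕ.+ 𝟙 (does (i ≟ b)))
        ≡⟨ ℕΣ.∑-distrib-+ (λ i → 𝟙 (does (i ≟ a))) (λ i → 𝟙 (does (i ≟ b))) ⟩
      ℕΣ.sum (λ i → 𝟙 (does (i ≟ a))) ℕ.+ ℕΣ.sum (λ i → 𝟙 (does (i ≟ b)))
        ≡⟨ cong₂ ℕ._+_ (sum-≟ a) (sum-≟ b) ⟩
      2 ∎
      where
      open ≡-Reasoning
      a = proj₁ (endpoints H k)
      b = proj₂ (endpoints H k)
      disjoint : ∀ i → 𝟙 (does (endpointOf? i k)) ≡ 𝟙 (does (i ≟ a)) ℕ.+ 𝟙 (does (i ≟ b))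
      disjoint i with i ≟ a
      ... | no _ = refl
      ... | yes refl = cong (suc ∘ 𝟙) (sym (dec-false (i ≟ b) (endpoints-≢ H k)))

  -- Of the four blocks of index pairs only vertex-edge contributes, since edges are listed with the
  -- smaller endpoint first. Summing that block over the vertices first gives 2 for each edge of H.
  size-sub : size (sub H) ≡ 2 ℕ.* size H
  size-sub = begin
    size (sub H)
      ≡⟨ length-filter-cartesianProduct (λ (i , j) → isEdge? i j) id id ⟩
    ℕΣ.sum (λ i → ℕΣ.sum (c i))
      ≡⟨ sum-↑ v (λ i → ℕΣ.sum (c i)) ⟩
    ℕΣ.sum (λ i → ℕΣ.sum (c (i ↑ˡ e))) ℕ.+ ℕΣ.sum (λ k → ℕΣ.sum (c (v ↑ʳ k)))
      ≡⟨ cong₂ ℕ._+_ (ℕΣ.sum-cong-≗ λ i → trans (sum-↑ v (c (i ↑ˡ e)))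
           (cong₂ ℕ._+_ (trans (ℕΣ.sum-cong-≗ (vertex-vertex i)) (ℕΣ.sum-replicate-zero v))
             (ℕΣ.sum-cong-≗ (cong 𝟙 ∘ vertex-edge i))))
           (trans (ℕΣ.sum-cong-≗ λ k → trans (ℕΣ.sum-cong-≗ (edge-any k)) (ℕΣ.sum-replicate-zero (v ℕ.+ e)))
             (ℕΣ.sum-replicate-zero e)) ⟩
    ℕΣ.sum (λ i → ℕΣ.sum λ k → 𝟙 (does (endpointOf? i k))) ℕ.+ 0
      ≡⟨ ℕ.+-identityʳ _ ⟩
    ℕΣ.sum (λ i → ℕΣ.sum λ k → 𝟙 (does (endpointOf? i k)))
      ≡⟨ ℕΣ.∑-comm (λ i k → 𝟙 (does (endpointOf? i k))) ⟩
    ℕΣ.sum (λ k → ℕΣ.sum λ i → 𝟙 (does (endpointOf? i k)))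
      ≡⟨ ℕΣ.sum-cong-≗ two-endpoints ⟩
    ℕΣ.sum {e} (λ _ → 2)
      ≡⟨ sum-twos e ⟩
    2 ℕ.* e ∎
    where
    open ≡-Reasoning
    open SumSplit ℕ.+-0-monoid
    c : ∀ i j → ℕ
    c i j = 𝟙 (does (isEdge? i j))
    sum-twos : ∀ n → ℕΣ.sum {n} (λ _ → 2) ≡ 2 ℕ.* n
    sum-twos zero    = refl
    sum-twos (suc n) = trans (cong (2 ℕ.+_) (sum-twos n)) (sym (ℕ.*-suc 2 n))

  sub-bipartite : Bipartite (sub H)
  sub-bipartite = colour ∘ splitAt v , λ {i} {j} → alternates (splitAt v i) (splitAt v j)
    where
    colour : Node → Bool
    colour = [ (λ _ → true) , (λ _ → false) ]
    alternates : ∀ x y → Incident x y → colour x ≢ colour y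
    alternates (inj₁ _) (inj₂ _) _ ()
    alternates (inj₂ _) (inj₁ _) _ ()

finToFun-combine : ∀ {n k} (i : Fin n) (c : Fin (n ℕ.^ k)) →
                   finToFun {n} {suc k} (combine i c) ≗ i ∷ finToFun c
finToFun-combine {n} {k} i c zero    = cong proj₁ (remQuot-combine i c)
finToFun-combine {n} {k} i c (suc j) = cong (λ qr → finToFun {n} {k} (proj₂ qr) j) (remQuot-combine i c)

-- Arithmetic in the ordered field

module _ {{R : Reals}} where
  open Reals R
  open CommutativeRing commutativeRing
    using (+-assoc; +-comm; *-assoc; *-comm; zeroˡ; zeroʳ; distribˡ;
           +-identityˡ; +-identityʳ; *-identityˡ; *-identityʳ;
           -‿inverseʳ; -‿inverseˡ; commutativeSemiring; semiring; ring; +-abelianGroup)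
  open Algebra.Properties.CommutativeSemiring.Exp commutativeSemiring
    using (^-homo-*; ^-assocʳ; ^-distrib-*)
  open Algebra.Properties.Ring ring using (-‿distribˡ-*; -‿distribʳ-*)
  open Algebra.Properties.AbelianGroup +-abelianGroup
    using () renaming (⁻¹-involutive to -‿involutive; ε⁻¹≈ε to -0≡0)

  decTotalOrder : DecTotalOrder 0ℓ 0ℓ 0ℓ
  decTotalOrder = record { isDecTotalOrder = isDecTotalOrder }

  open DecTotalOrder decTotalOrder
    using (poset)
    renaming (_≟_ to _≟ℝ_; refl to ≤-refl; reflexive to ≤-reflexive; trans to ≤-trans;
              antisym to ≤-antisym; total to ≤-total)
  open module Solver = Algebra.Solver.Ring.NaturalCoefficients.Default commutativeSemiring
    using (solve; _:=_; _:+_; _:*_)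
  module ≤-Reasoning = Relation.Binary.Reasoning.PartialOrder poset

  +-monoʳ-≤ : ∀ z {x y} → x ≤ y → z + x ≤ z + y
  +-monoʳ-≤ z {x} {y} x≤y = subst₂ _≤_ (+-comm x z) (+-comm y z) (+-monoˡ-≤ z x≤y)

  +-mono-≤ : ∀ {x y u v} → x ≤ y → u ≤ v → x + u ≤ y + v
  +-mono-≤ {y = y} {u} x≤y u≤v = ≤-trans (+-monoˡ-≤ u x≤y) (+-monoʳ-≤ y u≤v)

  +-nonNeg : ∀ {x y} → 0ℝ ≤ x → 0ℝ ≤ y → 0ℝ ≤ x + y
  +-nonNeg p q = subst (_≤ _) (+-identityˡ 0ℝ) (+-mono-≤ p q)

  x+y-y≡x : ∀ x y → x + y + - y ≡ x
  x+y-y≡x x y = trans (+-assoc x y (- y)) (trans (cong (x +_) (-‿inverseʳ y)) (+-identityʳ x))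

  x-y+y≡x : ∀ x y → x + - y + y ≡ x
  x-y+y≡x x y = trans (+-assoc x (- y) y) (trans (cong (x +_) (-‿inverseˡ y)) (+-identityʳ x))

  +-cancelʳ-≤ : ∀ z {x y} → x + z ≤ y + z → x ≤ y
  +-cancelʳ-≤ z {x} {y} p = subst₂ _≤_ (x+y-y≡x x z) (x+y-y≡x y z) (+-monoˡ-≤ (- z) p)

  x≤y+z⇒x-z≤y : ∀ {x y z} → x ≤ y + z → x + - z ≤ y
  x≤y+z⇒x-z≤y {x} {y} {z} p = +-cancelʳ-≤ z (subst (_≤ y + z) (sym (x-y+y≡x x z)) p)

  x≤x+y : ∀ x {y} → 0ℝ ≤ y → x ≤ x + y
  x≤x+y x {y} p = subst (_≤ x + y) (+-identityʳ x) (+-monoʳ-≤ x p)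

  x≤y⇒0≤y-x : ∀ {x y} → x ≤ y → 0ℝ ≤ y + - x
  x≤y⇒0≤y-x {x} p = subst (_≤ _) (-‿inverseʳ x) (+-monoˡ-≤ (- x) p)

  -- The solver works in commutative semirings, without negation. Inequalities are therefore turned
  -- into equations with an explicit nonnegative difference, by `≤-by` and `≤-difference`.
  ≤-by : ∀ {x y d} → 0ℝ ≤ d → x + d ≡ y → x ≤ y
  ≤-by {x} p eq = subst (x ≤_) eq (x≤x+y x p)

  ≤-difference : ∀ {x y} → x ≤ y → ∃ λ d → 0ℝ ≤ d × x + d ≡ y
  ≤-difference {x} {y} p = y + - x , x≤y⇒0≤y-x p , trans (+-comm x _) (x-y+y≡x y x)

  neg-nonNeg : ∀ {x} → x ≤ 0ℝ → 0ℝ ≤ - x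
  neg-nonNeg {x} p = subst (0ℝ ≤_) (+-identityˡ (- x)) (x≤y⇒0≤y-x p)

  *-monoʳ-≤ : ∀ {z x y} → 0ℝ ≤ z → x ≤ y → z * x ≤ z * y
  *-monoʳ-≤ {z} {x} {y} 0≤z p with d , 0≤d , refl ← ≤-difference p =
    ≤-by (*-nonNeg 0≤z 0≤d) (sym (distribˡ z x d))

  *-monoˡ-≤ : ∀ {z x y} → 0ℝ ≤ z → x ≤ y → x * z ≤ y * z
  *-monoˡ-≤ {z} {x} {y} 0≤z p = subst₂ _≤_ (*-comm z x) (*-comm z y) (*-monoʳ-≤ 0≤z p)

  *-mono-≤ : ∀ {x y u v} → 0ℝ ≤ x → 0ℝ ≤ v → x ≤ y → u ≤ v → x * u ≤ y * v
  *-mono-≤ 0≤x 0≤v p q = ≤-trans (*-monoʳ-≤ 0≤x q) (*-monoˡ-≤ 0≤v p)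

  neg*neg : ∀ x y → - x * - y ≡ x * y
  neg*neg x y = trans (sym (-‿distribˡ-* x (- y)))
    (trans (cong -_ (sym (-‿distribʳ-* x y))) (-‿involutive (x * y)))

  square-nonNeg : ∀ x → 0ℝ ≤ x * x
  square-nonNeg x with ≤-total 0ℝ x
  ... | inj₁ p = *-nonNeg p p
  ... | inj₂ p = subst (0ℝ ≤_) (neg*neg x x) (*-nonNeg (neg-nonNeg p) (neg-nonNeg p))

  0≤1 : 0ℝ ≤ 1ℝ
  0≤1 = subst (0ℝ ≤_) (*-identityˡ 1ℝ) (square-nonNeg 1ℝ)

  1≢0 : 1ℝ ≢ 0ℝ
  1≢0 = 0≢1 ∘ sym

  -- The inverse equals x (x⁻¹)², a product of nonnegative factors.
  ⁻¹-nonNeg : ∀ {x} → 0ℝ ≤ x → x ≢ 0ℝ → 0ℝ ≤ x ⁻¹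
  ⁻¹-nonNeg {x} 0≤x x≢0 = subst (0ℝ ≤_)
    (trans (sym (*-assoc x _ _)) (trans (cong (_* x ⁻¹) (*-inverseʳ x x≢0)) (*-identityˡ _)))
    (*-nonNeg 0≤x (square-nonNeg (x ⁻¹)))

  x*y*y⁻¹≡x : ∀ x {y} → y ≢ 0ℝ → x * y * y ⁻¹ ≡ x
  x*y*y⁻¹≡x x {y} y≢0 =
    trans (*-assoc x y _) (trans (cong (x *_) (*-inverseʳ y y≢0)) (*-identityʳ x))

  ÷-*-cancel : ∀ x {y} → y ≢ 0ℝ → x ÷ y * y ≡ x
  ÷-*-cancel x {y} y≢0 = trans (*-assoc x _ y)
    (trans (cong (x *_) (trans (*-comm _ y) (*-inverseʳ y y≢0))) (*-identityʳ x))

  *-cancelʳ-≤ : ∀ {x y z} → 0ℝ ≤ z → z ≢ 0ℝ → x * z ≤ y * z → x ≤ y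
  *-cancelʳ-≤ {x} {y} 0≤z z≢0 p = subst₂ _≤_ (x*y*y⁻¹≡x x z≢0) (x*y*y⁻¹≡x y z≢0)
    (*-monoˡ-≤ (⁻¹-nonNeg 0≤z z≢0) p)

  *-≢0 : ∀ {x y} → x ≢ 0ℝ → y ≢ 0ℝ → x * y ≢ 0ℝ
  *-≢0 {x} {y} x≢0 y≢0 xy≡0 = x≢0
    (trans (sym (x*y*y⁻¹≡x x y≢0)) (trans (cong (_* y ⁻¹) xy≡0) (zeroˡ _)))

  +-≢0ˡ : ∀ {x y} → 0ℝ ≤ x → 0ℝ ≤ y → x ≢ 0ℝ → x + y ≢ 0ℝ
  +-≢0ˡ {x} {y} 0≤x 0≤y x≢0 x+y≡0 =
    x≢0 (≤-antisym (subst (x ≤_) x+y≡0 (x≤x+y x 0≤y)) 0≤x)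

  ^-nonNeg : ∀ {x} n → 0ℝ ≤ x → 0ℝ ≤ x ^ n
  ^-nonNeg zero    0≤x = 0≤1
  ^-nonNeg (suc n) 0≤x = *-nonNeg 0≤x (^-nonNeg n 0≤x)

  ^-≢0 : ∀ {x} n → x ≢ 0ℝ → x ^ n ≢ 0ℝ
  ^-≢0 zero    x≢0 = 1≢0
  ^-≢0 (suc n) x≢0 = *-≢0 x≢0 (^-≢0 n x≢0)

  0^n≡0 : ∀ n .{{_ : NonZero n}} → 0ℝ ^ n ≡ 0ℝ
  0^n≡0 (suc n) = zeroˡ _

  1^n≡1 : ∀ n → 1ℝ ^ n ≡ 1ℝ
  1^n≡1 zero    = refl
  1^n≡1 (suc n) = trans (*-identityˡ _) (1^n≡1 n)

  ^-mono-≤ : ∀ {x y} n → 0ℝ ≤ x → x ≤ y → x ^ n ≤ y ^ n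
  ^-mono-≤ zero    0≤x x≤y = ≤-refl
  ^-mono-≤ (suc n) 0≤x x≤y =
    *-mono-≤ 0≤x (^-nonNeg n (≤-trans 0≤x x≤y)) x≤y (^-mono-≤ n 0≤x x≤y)

  -- This is how roots of inequalities are taken throughout. If y ≤ x and x is nonzero, then xⁿ⁺¹ ≤
  -- yⁿ⁺¹ ≤ y xⁿ, and xⁿ cancels; no strict order is involved.
  ^-cancel-≤ : ∀ {x y} n .{{_ : NonZero n}} → 0ℝ ≤ y → x ^ n ≤ y ^ n → x ≤ y
  ^-cancel-≤ {x} {y} (suc n) 0≤y p with ≤-total x y
  ... | inj₁ x≤y = x≤y
  ... | inj₂ y≤x with x ≟ℝ 0ℝ
  ...   | yes x≡0 = subst (_≤ y) (sym x≡0) 0≤y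
  ...   | no  x≢0 = *-cancelʳ-≤ (^-nonNeg n (≤-trans 0≤y y≤x)) (^-≢0 n x≢0)
    (≤-trans p (*-monoʳ-≤ 0≤y (^-mono-≤ n 0≤y y≤x)))

  ^-injective : ∀ {x y} n .{{_ : NonZero n}} → 0ℝ ≤ x → 0ℝ ≤ y → x ^ n ≡ y ^ n → x ≡ y
  ^-injective n 0≤x 0≤y p =
    ≤-antisym (^-cancel-≤ n 0≤y (≤-reflexive p)) (^-cancel-≤ n 0≤x (≤-reflexive (sym p)))

  x^2≡x*x : ∀ x → x ^ 2 ≡ x * x
  x^2≡x*x x = cong (x *_) (*-identityʳ x)

  ^-comm : ∀ x m n → (x ^ m) ^ n ≡ (x ^ n) ^ m
  ^-comm x m n = trans (^-assocʳ x m n) (trans (cong (x ^_) (ℕ.*-comm m n)) (sym (^-assocʳ x n m)))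

  1+x-nonNeg : ∀ {x} → 0ℝ ≤ x → 0ℝ ≤ 1ℝ + x
  1+x-nonNeg = +-nonNeg 0≤1

  1+x-≢0 : ∀ {x} → 0ℝ ≤ x → 1ℝ + x ≢ 0ℝ
  1+x-≢0 p = +-≢0ˡ 0≤1 p 1≢0

  1≤y⇒1≤y^n : ∀ {y} n → 1ℝ ≤ y → 1ℝ ≤ y ^ n
  1≤y⇒1≤y^n {y} n p = subst (_≤ y ^ n) (1^n≡1 n) (^-mono-≤ n 0≤1 p)

  -- Using 1 + x avoids distinguishing x ≤ 1 from x ≥ 1. It bounds the set whose supremum is the
  -- root, and later gives a crude constant without a root.
  x≤[1+x]^n : ∀ {x} n .{{_ : NonZero n}} → 0ℝ ≤ x → x ≤ (1ℝ + x) ^ n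
  x≤[1+x]^n {x} (suc n) 0≤x = ≤-trans (subst (x ≤_) (+-comm x 1ℝ) (x≤x+y x 0≤1))
    (subst (_≤ (1ℝ + x) ^ suc n) (*-identityʳ _) (*-monoʳ-≤ (1+x-nonNeg 0≤x)
      (1≤y⇒1≤y^n n (x≤x+y 1ℝ 0≤x))))

  y^n≤x⇒y≤1+x : ∀ {x y} n .{{_ : NonZero n}} → 0ℝ ≤ x → y ^ n ≤ x → y ≤ 1ℝ + x
  y^n≤x⇒y≤1+x n 0≤x p = ^-cancel-≤ n (1+x-nonNeg 0≤x) (≤-trans p (x≤[1+x]^n n 0≤x))

  -- This is n cⁿ⁻¹, the Lipschitz constant of the n-th power on [0, c], in a recursive form that
  -- avoids the exponent n - 1.
  lipschitz : ℝ → ℕ → ℝ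
  lipschitz c zero    = 0ℝ
  lipschitz c (suc n) = c * lipschitz c n + c ^ n

  lipschitz-nonNeg : ∀ {c} n → 0ℝ ≤ c → 0ℝ ≤ lipschitz c n
  lipschitz-nonNeg zero    0≤c = ≤-refl
  lipschitz-nonNeg (suc n) 0≤c = +-nonNeg (*-nonNeg 0≤c (lipschitz-nonNeg n 0≤c)) (^-nonNeg n 0≤c)

  ^-lipschitz : ∀ {b d c} n → 0ℝ ≤ b → 0ℝ ≤ d → b + d ≤ c →
                (b + d) ^ n ≤ b ^ n + lipschitz c n * d
  ^-lipschitz {b} {d} {c} zero 0≤b 0≤d a≤c = x≤x+y 1ℝ (subst (0ℝ ≤_) (sym (zeroˡ d)) ≤-refl)
  ^-lipschitz {b} {d} {c} (suc n) 0≤b 0≤d a≤c = begin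
    (b + d) * (b + d) ^ n               ≤⟨ *-monoʳ-≤ 0≤a (^-lipschitz n 0≤b 0≤d a≤c) ⟩
    (b + d) * (b ^ n + L * d)           ≡⟨ solve 4 (λ b d p L → (b :+ d) :* (p :+ L :* d) :=
                                             b :* p :+ (p :* d :+ (b :+ d) :* (L :* d))) refl b d (b ^ n) L ⟩
    b * b ^ n + (b ^ n * d + (b + d) * (L * d))
      ≤⟨ +-monoʳ-≤ _ (+-mono-≤ (*-monoˡ-≤ 0≤d (^-mono-≤ n 0≤b (≤-trans (x≤x+y b 0≤d) a≤c)))
           (*-monoˡ-≤ (*-nonNeg (lipschitz-nonNeg n 0≤c) 0≤d) a≤c)) ⟩
    b * b ^ n + (c ^ n * d + c * (L * d)) ≡⟨ cong (b * b ^ n +_) (solve 4 (λ c p L d →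
                                             p :* d :+ c :* (L :* d) := (c :* L :+ p) :* d) refl c (c ^ n) L d) ⟩
    b * b ^ n + (c * L + c ^ n) * d     ∎
    where
    open ≤-Reasoning
    L = lipschitz c n
    0≤a = +-nonNeg 0≤b 0≤d
    0≤c = ≤-trans 0≤a a≤c

  -- Roots

  module Root (n : ℕ) .{{_ : NonZero n}} {x : ℝ} (0≤x : 0ℝ ≤ x) where
    private
      P : ℝ → Set
      P y = 0ℝ ≤ y × y ^ n ≤ x

      P0 : P 0ℝ
      P0 = ≤-refl , subst (_≤ x) (sym (0^n≡0 n)) 0≤x

      r : ℝ
      r = root n x

      upper : ∀ y → P y → y ≤ r
      upper = sup-upper P (0ℝ , P0) (1ℝ + x , λ y Py → y^n≤x⇒y≤1+x n 0≤x (proj₂ Py))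

    root-nonNeg : 0ℝ ≤ root n x
    root-nonNeg = upper 0ℝ P0

    private
      -- The interval [0, r + 1] contains all points compared in both halves of the argument. The
      -- summand 1 makes `D` nonzero, hence usable as a denominator; the second half enlarges it by
      -- g so that its increment stays below 1.
      D : ℝ
      D = 1ℝ + lipschitz (r + 1ℝ) n

      0≤L : 0ℝ ≤ lipschitz (r + 1ℝ) n
      0≤L = lipschitz-nonNeg n (+-nonNeg root-nonNeg 0≤1)

      0≤D : 0ℝ ≤ D
      0≤D = 1+x-nonNeg 0≤L

      L≤D : lipschitz (r + 1ℝ) n ≤ D
      L≤D = subst (lipschitz (r + 1ℝ) n ≤_) (+-comm _ 1ℝ) (x≤x+y _ 0≤1)

      -- Otherwise r − (rⁿ − x) / D would be a smaller upper bound.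
      r^n≤x : r ^ n ≤ x
      r^n≤x = subst₂ _≤_ (x-y+y≡x (r ^ n) x) (+-identityˡ x) (+-monoˡ-≤ x g≤0)
        where
        g = r ^ n + - x
        bound : ∀ y → P y → y ≤ r + - (g ÷ D)
        bound y (0≤y , y^n≤x) with d , 0≤d , y+d≡r ← ≤-difference (upper y (0≤y , y^n≤x)) =
          subst (_≤ r + - (g ÷ D)) (x+y-y≡x y (g ÷ D)) (+-monoˡ-≤ (- (g ÷ D))
            (subst (y + g ÷ D ≤_) y+d≡r (+-monoʳ-≤ y (*-cancelʳ-≤ 0≤D (1+x-≢0 0≤L)
              (subst (_≤ d * D) (sym (÷-*-cancel g (1+x-≢0 0≤L))) (x≤y+z⇒x-z≤y step))))))
          where
          step : r ^ n ≤ d * D + x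
          step = begin
            r ^ n                            ≡⟨ cong (_^ n) y+d≡r ⟨
            (y + d) ^ n                      ≤⟨ ^-lipschitz n 0≤y 0≤d
                                                 (subst (_≤ r + 1ℝ) (sym y+d≡r) (x≤x+y r 0≤1)) ⟩
            y ^ n + lipschitz (r + 1ℝ) n * d ≤⟨ +-mono-≤ y^n≤x (*-monoˡ-≤ 0≤d L≤D) ⟩
            x + D * d                        ≡⟨ trans (+-comm x _) (cong (_+ x) (*-comm D d)) ⟩
            d * D + x                        ∎
            where open ≤-Reasoning
        g≤0 : g ≤ 0ℝ
        g≤0 = subst₂ _≤_ (÷-*-cancel g (1+x-≢0 0≤L)) (zeroˡ D) (*-monoˡ-≤ 0≤D
          (+-cancelʳ-≤ r (subst₂ _≤_ (+-comm r (g ÷ D)) (sym (+-identityˡ r))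
            (subst (r + g ÷ D ≤_) (x-y+y≡x r (g ÷ D))
              (+-monoˡ-≤ (g ÷ D) (sup-least P (0ℝ , P0) _ bound))))))

      -- Otherwise r + (x − rⁿ) / (D + (x − rⁿ)) would satisfy P.
      x≤r^n : x ≤ r ^ n
      x≤r^n with ≤-difference r^n≤x
      ... | g , 0≤g , r^n+g≡x = subst (_≤ r ^ n) r^n+g≡x
              (subst (r ^ n + g ≤_) (+-identityʳ _) (+-monoʳ-≤ (r ^ n) g≤0))
        where
        E = D + g
        0≤E = +-nonNeg 0≤D 0≤g
        E≢0 = +-≢0ˡ 0≤D 0≤g (1+x-≢0 0≤L)
        δ = g ÷ E
        0≤δ = *-nonNeg 0≤g (⁻¹-nonNeg 0≤E E≢0)
        δ≤1 : δ ≤ 1ℝ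
        δ≤1 = *-cancelʳ-≤ 0≤E E≢0 (subst₂ _≤_ (sym (÷-*-cancel g E≢0)) (sym (*-identityˡ E))
          (subst (g ≤_) (+-comm g D) (x≤x+y g 0≤D)))
        [r+δ]^n≤x : (r + δ) ^ n ≤ x
        [r+δ]^n≤x = begin
          (r + δ) ^ n                      ≤⟨ ^-lipschitz n root-nonNeg 0≤δ (+-monoʳ-≤ r δ≤1) ⟩
          r ^ n + lipschitz (r + 1ℝ) n * δ ≤⟨ +-monoʳ-≤ _ (*-monoˡ-≤ 0≤δ (≤-trans L≤D (x≤x+y D 0≤g))) ⟩
          r ^ n + E * δ                    ≡⟨ cong (r ^ n +_) (trans (*-comm E δ) (÷-*-cancel g E≢0)) ⟩
          r ^ n + g                        ≡⟨ r^n+g≡x ⟩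
          x                                ∎
          where open ≤-Reasoning
        δ≤0 : δ ≤ 0ℝ
        δ≤0 = +-cancelʳ-≤ r (subst₂ _≤_ (+-comm r δ) (sym (+-identityˡ r))
          (upper (r + δ) (+-nonNeg root-nonNeg 0≤δ , [r+δ]^n≤x)))
        g≤0 : g ≤ 0ℝ
        g≤0 = subst₂ _≤_ (÷-*-cancel g E≢0) (zeroˡ E) (*-monoˡ-≤ 0≤E δ≤0)

    root-^ : root n x ^ n ≡ x
    root-^ = ≤-antisym r^n≤x x≤r^n

  open Root using (root-nonNeg; root-^)

  open Algebra.Properties.Semiring.Sum semiring
    using (*-distribˡ-sum; *-distribʳ-sum; ∑-distrib-+; ∑-comm)
    renaming (sum-cong-≗ to sum-cong)

  -- Sums and Hölder's inequality

  sum-nonNeg : ∀ {n} {f : Vector ℝ n} → (∀ i → 0ℝ ≤ f i) → 0ℝ ≤ sum f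
  sum-nonNeg {zero}  0≤f = ≤-refl
  sum-nonNeg {suc n} 0≤f = +-nonNeg (0≤f zero) (sum-nonNeg (0≤f ∘ suc))

  sum-mono-≤ : ∀ {n} {f g : Vector ℝ n} → (∀ i → f i ≤ g i) → sum f ≤ sum g
  sum-mono-≤ {zero}  f≤g = ≤-refl
  sum-mono-≤ {suc n} f≤g = +-mono-≤ (f≤g zero) (sum-mono-≤ (f≤g ∘ suc))

  term≤sum : ∀ {n} {f : Vector ℝ n} → (∀ i → 0ℝ ≤ f i) → ∀ i → f i ≤ sum f
  term≤sum {f = f} 0≤f zero = x≤x+y _ (sum-nonNeg (0≤f ∘ suc))
  term≤sum {suc n} {f} 0≤f (suc i) = ≤-trans (term≤sum (0≤f ∘ suc) i)
    (subst (sum (f ∘ suc) ≤_) (+-comm _ _) (x≤x+y _ (0≤f zero)))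

  -- After squaring, 4c² ≤ 4uv ≤ (u + v)², where the last gap is the square of the difference of u
  -- and v. The comparison of u with v only serves to name that difference without subtraction.
  am-gm : ∀ {c u v} → 0ℝ ≤ u → 0ℝ ≤ v → c * c ≤ u * v → c + c ≤ u + v
  am-gm {c} {u} {v} 0≤u 0≤v p = ^-cancel-≤ 2 (+-nonNeg 0≤u 0≤v)
    (subst₂ _≤_ (sym (x^2≡x*x (c + c))) (sym (x^2≡x*x (u + v))) (begin
      (c + c) * (c + c)                 ≡⟨ solve 1 (λ c → (c :+ c) :* (c :+ c) :=
                                             (c :* c :+ c :* c) :+ (c :* c :+ c :* c)) refl c ⟩
      (c * c + c * c) + (c * c + c * c) ≤⟨ +-mono-≤ (+-mono-≤ p p) (+-mono-≤ p p) ⟩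
      (u * v + u * v) + (u * v + u * v) ≤⟨ four-uv ⟩
      (u + v) * (u + v)                 ∎))
    where
    open ≤-Reasoning
    four-uv : (u * v + u * v) + (u * v + u * v) ≤ (u + v) * (u + v)
    four-uv with ≤-total u v
    ... | inj₁ u≤v with d , _ , refl ← ≤-difference u≤v = ≤-by (square-nonNeg d)
      (solve 2 (λ u d → (u :* (u :+ d) :+ u :* (u :+ d)) :+ (u :* (u :+ d) :+ u :* (u :+ d))
        :+ d :* d := (u :+ (u :+ d)) :* (u :+ (u :+ d))) refl u d)
    ... | inj₂ v≤u with d , _ , refl ← ≤-difference v≤u = ≤-by (square-nonNeg d)
      (solve 2 (λ v d → ((v :+ d) :* v :+ (v :+ d) :* v) :+ ((v :+ d) :* v :+ (v :+ d) :* v)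
        :+ d :* d := ((v :+ d) :+ v) :* ((v :+ d) :+ v)) refl v d)

  -- The inequality c ≤ √(p q); it is preserved by sums, which is Cauchy–Schwarz.
  record GeometricBound (c p q : ℝ) : Set where
    constructor geometricBound
    field
      p-nonNeg : 0ℝ ≤ p
      q-nonNeg : 0ℝ ≤ q
      bound    : c * c ≤ p * q

  -- Only the mixed terms need an argument: (cc′)² ≤ (pq′)(p′q), so AM-GM bounds 2cc′ by pq′ + p′q.
  geometricBound-+ : ∀ {c p q c′ p′ q′} → GeometricBound c p q → GeometricBound c′ p′ q′ →
                     GeometricBound (c + c′) (p + p′) (q + q′)
  geometricBound-+ {c} {p} {q} {c′} {p′} {q′} (geometricBound 0≤p 0≤q b) (geometricBound 0≤p′ 0≤q′ b′) =
    geometricBound (+-nonNeg 0≤p 0≤p′) (+-nonNeg 0≤q 0≤q′) (begin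
      (c + c′) * (c + c′)                       ≡⟨ solve 2 (λ c d → (c :+ d) :* (c :+ d) :=
                                                     (c :* c :+ d :* d) :+ (c :* d :+ c :* d)) refl c c′ ⟩
      (c * c + c′ * c′) + (c * c′ + c * c′)     ≤⟨ +-mono-≤ (+-mono-≤ b b′) cross ⟩
      (p * q + p′ * q′) + (p * q′ + p′ * q)
        ≡⟨ solve 4 (λ p q r s → (p :* q :+ r :* s) :+ (p :* s :+ r :* q)
                                                     := (p :+ r) :* (q :+ s)) refl p q p′ q′ ⟩
      (p + p′) * (q + q′)                       ∎)
    where
    open ≤-Reasoning
    cross : c * c′ + c * c′ ≤ p * q′ + p′ * q
    cross = am-gm (*-nonNeg 0≤p 0≤q′) (*-nonNeg 0≤p′ 0≤q) (begin
      c * c′ * (c * c′)       ≡⟨ solve 2 (λ c d → c :* d :* (c :* d) := c :* c :* (d :* d)) refl c c′ ⟩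
      c * c * (c′ * c′)       ≤⟨ *-mono-≤ (square-nonNeg c) (*-nonNeg 0≤p′ 0≤q′) b b′ ⟩
      p * q * (p′ * q′)
        ≡⟨ solve 4 (λ p q r s → p :* q :* (r :* s) := p :* s :* (r :* q)) refl p q p′ q′ ⟩
      p * q′ * (p′ * q)       ∎)

  geometricBound-sum : ∀ {n} {c p q : Vector ℝ n} → (∀ i → GeometricBound (c i) (p i) (q i)) →
                       GeometricBound (sum c) (sum p) (sum q)
  geometricBound-sum {zero}  b = geometricBound ≤-refl ≤-refl ≤-refl
  geometricBound-sum {suc n} b = geometricBound-+ (b zero) (geometricBound-sum (b ∘ suc))

  -- The moments Σ aⁱ bʲ of fixed degree i + j are log-convex by Cauchy–Schwarz;
  -- chaining these inequalities gives Hölder for integer exponents, without roots.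
  module Hölder {n} {a b : Vector ℝ n} (0≤a : ∀ i → 0ℝ ≤ a i) (0≤b : ∀ i → 0ℝ ≤ b i) where
    moment : ℕ → ℕ → ℝ
    moment i j = sum λ l → a l ^ i * b l ^ j

    moment-nonNeg : ∀ i j → 0ℝ ≤ moment i j
    moment-nonNeg i j = sum-nonNeg λ l → *-nonNeg (^-nonNeg i (0≤a l)) (^-nonNeg j (0≤b l))

    private
      logConvex : ∀ i j → moment (suc i) (suc j) * moment (suc i) (suc j)
                          ≤ moment i (2 ℕ.+ j) * moment (2 ℕ.+ i) j
      logConvex i j = GeometricBound.bound (geometricBound-sum λ l → geometricBound
        (*-nonNeg (^-nonNeg i (0≤a l)) (^-nonNeg (2 ℕ.+ j) (0≤b l)))
        (*-nonNeg (^-nonNeg (2 ℕ.+ i) (0≤a l)) (^-nonNeg j (0≤b l)))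
        (≤-reflexive (solve 4 (λ a b u v → a :* u :* (b :* v) :* (a :* u :* (b :* v))
                                := u :* (b :* (b :* v)) :* (a :* (a :* u) :* v))
                      refl (a l) (b l) (a l ^ i) (b l ^ j))))

      -- At fixed degree, the logarithm of the moment at j lies below the chord from 0 to j + 1. The
      -- induction raises log-convexity at suc j to a power, bounds `z` by the hypothesis and
      -- cancels `x ^ j`, which is why x = 0 is separated.
      step : ∀ j r → moment j (suc r) ^ suc j ≤ moment 0 (j ℕ.+ suc r) * moment (suc j) r ^ j
      step zero    r = ≤-refl
      step (suc j) r with moment (suc j) (suc r) ≟ℝ 0ℝ
      ... | yes x≡0 = subst (_≤ moment 0 (suc j ℕ.+ suc r) * moment (2 ℕ.+ j) r ^ suc j)
        (sym (trans (cong (_^ (2 ℕ.+ j)) x≡0) (0^n≡0 (2 ℕ.+ j))))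
        (*-nonNeg (moment-nonNeg 0 (suc j ℕ.+ suc r)) (^-nonNeg (suc j) (moment-nonNeg (2 ℕ.+ j) r)))
      ... | no  x≢0 = *-cancelʳ-≤ (^-nonNeg j 0≤x) (^-≢0 j x≢0) (begin
        x ^ (2 ℕ.+ j) * x ^ j
          ≡⟨ solve 2 (λ x p → x :* (x :* p) :* p := x :* p :* (x :* p)) refl x (x ^ j) ⟩
        x ^ suc j * x ^ suc j         ≡⟨ ^-distrib-* x x (suc j) ⟨
        (x * x) ^ suc j               ≤⟨ ^-mono-≤ (suc j) (square-nonNeg x) (logConvex j r) ⟩
        (z * y) ^ suc j               ≡⟨ ^-distrib-* z y (suc j) ⟩
        z ^ suc j * y ^ suc j
          ≤⟨ *-monoˡ-≤ (^-nonNeg (suc j) (moment-nonNeg (2 ℕ.+ j) r)) (step j (suc r)) ⟩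
        moment 0 (j ℕ.+ (2 ℕ.+ r)) * x ^ j * y ^ suc j
                                      ≡⟨ cong (λ k → moment 0 k * x ^ j * y ^ suc j) (ℕ.+-suc j (suc r)) ⟩
        e * x ^ j * y ^ suc j
          ≡⟨ solve 3 (λ e p q → e :* p :* q := e :* q :* p) refl e (x ^ j) (y ^ suc j) ⟩
        e * y ^ suc j * x ^ j         ∎)
        where
        open ≤-Reasoning
        x = moment (suc j) (suc r)
        y = moment (2 ℕ.+ j) r
        z = moment j (2 ℕ.+ r)
        e = moment 0 (suc j ℕ.+ suc r)
        0≤x = moment-nonNeg (suc j) (suc r)

      -- The same for the chord from 0 to m + d, evaluated at m. In the induction on d, the chord
      -- ending at j = m + d is prolonged to j + 1 by `step`; eliminating the moment at j leaves
      -- j-th powers on both sides, and these cancel.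
      steps : ∀ m .{{_ : NonZero m}} d r → moment m (d ℕ.+ r) ^ (m ℕ.+ d) ≤
              moment 0 (m ℕ.+ d ℕ.+ r) ^ d * moment (m ℕ.+ d) r ^ m
      steps m zero r rewrite ℕ.+-identityʳ m = ≤-reflexive (sym (*-identityˡ _))
      steps m (suc d) r rewrite ℕ.+-suc m d = ^-cancel-≤ j {{j≢0}}
        (*-nonNeg (^-nonNeg (suc d) 0≤e) (^-nonNeg m 0≤y)) (begin
        (x ^ suc j) ^ j               ≡⟨ ^-comm x (suc j) j ⟩
        (x ^ j) ^ suc j               ≤⟨ ^-mono-≤ (suc j) (^-nonNeg j (moment-nonNeg m (suc d ℕ.+ r))) step₁ ⟩
        (e ^ d * z ^ m) ^ suc j       ≡⟨ ^-distrib-* (e ^ d) (z ^ m) (suc j) ⟩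
        (e ^ d) ^ suc j * (z ^ m) ^ suc j
                                      ≡⟨ cong ((e ^ d) ^ suc j *_) (^-comm z m (suc j)) ⟩
        (e ^ d) ^ suc j * (z ^ suc j) ^ m
                                      ≤⟨ *-monoʳ-≤ (^-nonNeg (suc j) (^-nonNeg d 0≤e))
                                           (^-mono-≤ m (^-nonNeg (suc j) (moment-nonNeg j (suc r))) step₂) ⟩
        (e ^ d) ^ suc j * (e * y ^ j) ^ m
                                      ≡⟨ cong₂ _*_ (^-assocʳ e d (suc j)) (^-distrib-* e (y ^ j) m) ⟩
        e ^ (d ℕ.* suc j) * (e ^ m * (y ^ j) ^ m)
                                      ≡⟨ *-assoc _ _ _ ⟨
        e ^ (d ℕ.* suc j) * e ^ m * (y ^ j) ^ m
                                      ≡⟨ cong₂ _*_ (trans (sym (^-homo-* e (d ℕ.* suc j) m))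
                                           (trans (cong (e ^_) (exponents m d)) (sym (^-assocʳ e (suc d) j))))
                                           (^-comm y j m) ⟩
        (e ^ suc d) ^ j * (y ^ m) ^ j ≡⟨ ^-distrib-* (e ^ suc d) (y ^ m) j ⟨
        (e ^ suc d * y ^ m) ^ j       ∎)
        where
        open ≤-Reasoning
        j = m ℕ.+ d
        j≢0 : NonZero j
        j≢0 = ℕ.>-nonZero (ℕ.<-≤-trans (ℕ.>-nonZero⁻¹ m) (ℕ.m≤m+n m d))
        exponents : ∀ m d → d ℕ.* suc (m ℕ.+ d) ℕ.+ m ≡ suc d ℕ.* (m ℕ.+ d)
        exponents = solve-∀
        x = moment m (suc d ℕ.+ r)
        y = moment (suc j) r
        z = moment j (suc r)
        e = moment 0 (suc j ℕ.+ r)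
        0≤e = moment-nonNeg 0 (suc j ℕ.+ r)
        0≤y = moment-nonNeg (suc j) r
        step₁ : x ^ j ≤ e ^ d * z ^ m
        step₁ = subst₂ (λ p q → moment m p ^ j ≤ moment 0 q ^ d * z ^ m)
          (ℕ.+-suc d r) (ℕ.+-suc j r) (steps m d (suc r))
        step₂ : z ^ suc j ≤ e * y ^ j
        step₂ = subst (λ q → z ^ suc j ≤ moment 0 q * y ^ j) (ℕ.+-suc j r) (step j r)

    -- The chord over the whole range, r = 0. It is Hölder for the conjugate exponents (m + k) / m
    -- and (m + k) / k, raised to the power m + k.
    hölder : ∀ m k .{{_ : NonZero m}} → sum (λ l → a l ^ m * b l ^ k) ^ (m ℕ.+ k) ≤
             sum (λ l → a l ^ (m ℕ.+ k)) ^ m * sum (λ l → b l ^ (m ℕ.+ k)) ^ k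
    hölder m k = begin
      moment m k ^ (m ℕ.+ k)             ≡⟨ cong (λ i → moment m i ^ (m ℕ.+ k)) (ℕ.+-identityʳ k) ⟨
      moment m (k ℕ.+ 0) ^ (m ℕ.+ k)     ≤⟨ steps m k 0 ⟩
      moment 0 (m ℕ.+ k ℕ.+ 0) ^ k * moment (m ℕ.+ k) 0 ^ m
        ≡⟨ cong (λ i → moment 0 i ^ k * moment (m ℕ.+ k) 0 ^ m) (ℕ.+-identityʳ (m ℕ.+ k)) ⟩
      moment 0 (m ℕ.+ k) ^ k * moment (m ℕ.+ k) 0 ^ m
        ≡⟨ *-comm _ _ ⟩
      moment (m ℕ.+ k) 0 ^ m * moment 0 (m ℕ.+ k) ^ k
        ≡⟨ cong₂ (λ p q → p ^ m * q ^ k)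
             (sum-cong λ l → *-identityʳ (a l ^ (m ℕ.+ k)))
             (sum-cong λ l → *-identityˡ (b l ^ (m ℕ.+ k))) ⟩
      sum (λ l → a l ^ (m ℕ.+ k)) ^ m * sum (λ l → b l ^ (m ℕ.+ k)) ^ k ∎
      where open ≤-Reasoning

  open Hölder using (hölder)

  -- Absolute values and norms

  abs-nonNeg : ∀ x → 0ℝ ≤ abs x
  abs-nonNeg x with 0ℝ ≤? x
  ... | yes p = p
  ... | no ¬p with ≤-total 0ℝ x
  ...   | inj₁ p = contradiction p ¬p
  ...   | inj₂ p = neg-nonNeg p

  0≤x⇒abs≡x : ∀ {x} → 0ℝ ≤ x → abs x ≡ x
  0≤x⇒abs≡x {x} 0≤x with 0ℝ ≤? x
  ... | yes _ = refl
  ... | no ¬p = contradiction 0≤x ¬p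

  abs≡0⇒≡0 : ∀ {x} → abs x ≡ 0ℝ → x ≡ 0ℝ
  abs≡0⇒≡0 {x} eq with 0ℝ ≤? x
  ... | yes _ = eq
  ... | no  _ = trans (sym (-‿involutive x)) (trans (cong -_ eq) -0≡0)

  x≤abs : ∀ x → x ≤ abs x
  x≤abs x with 0ℝ ≤? x
  ... | yes _ = ≤-refl
  ... | no ¬p with ≤-total 0ℝ x
  ...   | inj₁ p = contradiction p ¬p
  ...   | inj₂ p = ≤-trans p (neg-nonNeg p)

  0≤abs+x : ∀ x → 0ℝ ≤ abs x + x
  0≤abs+x x with 0ℝ ≤? x
  ... | yes p = +-nonNeg p p
  ... | no ¬p = ≤-reflexive (sym (-‿inverseˡ x))

  -- The lower bound -y ≤ x is phrased as 0 ≤ y + x so that for sums it follows term by term from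
  -- `0≤abs+x`.
  abs-≤ : ∀ {x y} → x ≤ y → 0ℝ ≤ y + x → abs x ≤ y
  abs-≤ {x} {y} x≤y 0≤y+x with 0ℝ ≤? x
  ... | yes _ = x≤y
  ... | no  _ = subst₂ _≤_ (+-identityˡ (- x)) (x+y-y≡x y x) (+-monoˡ-≤ (- x) 0≤y+x)

  abs-apply-≤ : ∀ {n} {A : Matrix n} → NonNegative A → ∀ (x : Vector ℝ n) i →
                abs (apply A x i) ≤ sum λ j → A i j * abs (x j)
  abs-apply-≤ {A = A} 0≤A x i = abs-≤
    (sum-mono-≤ λ j → *-monoʳ-≤ (0≤A i j) (x≤abs (x j)))
    (subst (0ℝ ≤_) (∑-distrib-+ (λ j → A i j * abs (x j)) (λ j → A i j * x j))
      (sum-nonNeg λ j → subst (0ℝ ≤_) (distribˡ (A i j) (abs (x j)) (x j))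
        (*-nonNeg (0≤A i j) (0≤abs+x (x j)))))

  apply-nonNeg : ∀ {n} {A : Matrix n} → NonNegative A → ∀ {x : Vector ℝ n} → (∀ i → 0ℝ ≤ x i) →
                 ∀ i → 0ℝ ≤ apply A x i
  apply-nonNeg 0≤A 0≤x i = sum-nonNeg λ j → *-nonNeg (0≤A i j) (0≤x j)

  -- Matching on `suc` makes the fraction, and in `pow-recip` its inverse, compute. Afterwards
  -- exponents are handled only through a and b.
  pow-ratio : ∀ a b .{{_ : NonZero a}} .{{_ : NonZero b}} x → pow x (ratio a b) ≡ root b (x ^ a)
  pow-ratio (suc a) (suc b) x = refl

  pow-recip : ∀ a b .{{_ : NonZero a}} .{{_ : NonZero b}} x → pow x (recip (ratio a b)) ≡ root a (x ^ b)
  pow-recip (suc a) (suc b) x = refl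

  module Ratio (a b : ℕ) .{{_ : NonZero a}} .{{_ : NonZero b}} where
    pow-t^b : ∀ {t} → 0ℝ ≤ t → pow (t ^ b) (ratio a b) ≡ t ^ a
    pow-t^b {t} 0≤t = ^-injective b
      (subst (0ℝ ≤_) (sym (pow-ratio a b (t ^ b))) (root-nonNeg b 0≤t^b^a)) (^-nonNeg a 0≤t)
      (trans (cong (_^ b) (pow-ratio a b (t ^ b))) (trans (root-^ b 0≤t^b^a) (^-comm t b a)))
      where 0≤t^b^a = ^-nonNeg a (^-nonNeg b 0≤t)

    module _ {n} {x t : Vector ℝ n} (0≤t : ∀ i → 0ℝ ≤ t i) (t^b≡∣x∣ : ∀ i → t i ^ b ≡ abs (x i)) where
      norm≡root : ∥ x ∥[ ratio a b ] ≡ root a (sum (λ i → t i ^ a) ^ b)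
      norm≡root = trans (pow-recip a b _) (cong (λ s → root a (s ^ b))
        (sum-cong λ i → trans (cong (λ y → pow y (ratio a b)) (sym (t^b≡∣x∣ i))) (pow-t^b (0≤t i))))

      power-sum-nonNeg : 0ℝ ≤ sum (λ i → t i ^ a) ^ b
      power-sum-nonNeg = ^-nonNeg b (sum-nonNeg λ i → ^-nonNeg a (0≤t i))

      norm-^ : ∥ x ∥[ ratio a b ] ^ a ≡ sum (λ i → t i ^ a) ^ b
      norm-^ = trans (cong (_^ a) norm≡root) (root-^ a power-sum-nonNeg)

    absRoot : ∀ {n} → Vector ℝ n → Vector ℝ n
    absRoot x i = root b (abs (x i))

    absRoot-nonNeg : ∀ {n} (x : Vector ℝ n) i → 0ℝ ≤ absRoot x i
    absRoot-nonNeg x i = root-nonNeg b (abs-nonNeg (x i))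

    absRoot-^ : ∀ {n} (x : Vector ℝ n) i → absRoot x i ^ b ≡ abs (x i)
    absRoot-^ x i = root-^ b (abs-nonNeg (x i))

    norm-nonNeg : ∀ {n} (x : Vector ℝ n) → 0ℝ ≤ ∥ x ∥[ ratio a b ]
    norm-nonNeg x = subst (0ℝ ≤_) (sym (norm≡root (absRoot-nonNeg x) (absRoot-^ x)))
      (root-nonNeg a (power-sum-nonNeg (absRoot-nonNeg x) (absRoot-^ x)))

    abs≤norm : ∀ {n} (x : Vector ℝ n) i → abs (x i) ≤ ∥ x ∥[ ratio a b ]
    abs≤norm x i = ^-cancel-≤ a (norm-nonNeg x) (begin
      abs (x i) ^ a                  ≡⟨ cong (_^ a) (absRoot-^ x i) ⟨
      (absRoot x i ^ b) ^ a          ≡⟨ ^-comm (absRoot x i) b a ⟩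
      (absRoot x i ^ a) ^ b          ≤⟨ ^-mono-≤ b (0≤t^a i) (term≤sum 0≤t^a i) ⟩
      sum (λ i → absRoot x i ^ a) ^ b ≡⟨ norm-^ (absRoot-nonNeg x) (absRoot-^ x) ⟨
      ∥ x ∥[ ratio a b ] ^ a         ∎)
      where
      open ≤-Reasoning
      0≤t^a : ∀ i → 0ℝ ≤ absRoot x i ^ a
      0≤t^a i = ^-nonNeg a (absRoot-nonNeg x i)

    norm≢0 : ∀ {n} {x : Vector ℝ n} → ¬ (∀ i → x i ≡ 0ℝ) → ∥ x ∥[ ratio a b ] ≢ 0ℝ
    norm≢0 {x = x} x≢0 ∥x∥≡0 = x≢0 λ i → abs≡0⇒≡0
      (≤-antisym (subst (abs (x i) ≤_) ∥x∥≡0 (abs≤norm x i)) (abs-nonNeg (x i)))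

    -- The sharp constant is n^{b/a}. This larger one needs no root, and finiteness is all that is
    -- asked of it.
    supNormFactor : ℕ → ℝ
    supNormFactor n = 1ℝ + sum {n} (λ _ → 1ℝ) ^ b

    supNormFactor-nonNeg : ∀ n → 0ℝ ≤ supNormFactor n
    supNormFactor-nonNeg n = 1+x-nonNeg (^-nonNeg b (sum-nonNeg {n} λ _ → 0≤1))

    norm≤ : ∀ {n} (x : Vector ℝ n) {c} → 0ℝ ≤ c → (∀ i → abs (x i) ≤ c) →
            ∥ x ∥[ ratio a b ] ≤ supNormFactor n * c
    norm≤ {n} x {c} 0≤c ∣x∣≤c = ^-cancel-≤ a (*-nonNeg (supNormFactor-nonNeg n) 0≤c) (begin
      ∥ x ∥[ ratio a b ] ^ a            ≡⟨ norm-^ (absRoot-nonNeg x) (absRoot-^ x) ⟩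
      sum (λ i → absRoot x i ^ a) ^ b   ≤⟨ ^-mono-≤ b (sum-nonNeg λ i → ^-nonNeg a (absRoot-nonNeg x i))
                                             (sum-mono-≤ t^a≤ρ^a) ⟩
      sum {n} (λ _ → 1ℝ * ρ ^ a) ^ b    ≡⟨ cong (_^ b) (*-distribʳ-sum {n} (ρ ^ a) (λ _ → 1ℝ)) ⟨
      (sum {n} (λ _ → 1ℝ) * ρ ^ a) ^ b  ≡⟨ ^-distrib-* (sum {n} (λ _ → 1ℝ)) (ρ ^ a) b ⟩
      sum {n} (λ _ → 1ℝ) ^ b * (ρ ^ a) ^ b
        ≡⟨ cong (sum {n} (λ _ → 1ℝ) ^ b *_) (trans (^-comm ρ a b) (cong (_^ a) (root-^ b 0≤c))) ⟩
      sum {n} (λ _ → 1ℝ) ^ b * c ^ a    ≤⟨ *-monoˡ-≤ (^-nonNeg a 0≤c)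
                                             (x≤[1+x]^n a (^-nonNeg b (sum-nonNeg {n} λ _ → 0≤1))) ⟩
      supNormFactor n ^ a * c ^ a       ≡⟨ ^-distrib-* (supNormFactor n) c a ⟨
      (supNormFactor n * c) ^ a         ∎)
      where
      open ≤-Reasoning
      ρ = root b c
      t^a≤ρ^a : ∀ i → absRoot x i ^ a ≤ 1ℝ * ρ ^ a
      t^a≤ρ^a i = subst (absRoot x i ^ a ≤_) (sym (*-identityˡ (ρ ^ a)))
        (^-mono-≤ a (absRoot-nonNeg x i) (^-cancel-≤ b (root-nonNeg b 0≤c)
          (subst₂ _≤_ (sym (absRoot-^ x i)) (sym (root-^ b 0≤c)) (∣x∣≤c i))))

  open Ratio

  -- Operator norms as suprema

  module OpNorm {n} (A : Matrix n) (a b c d : ℕ)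
    .{{_ : NonZero a}} .{{_ : NonZero b}} .{{_ : NonZero c}} .{{_ : NonZero d}} where
    private
      p r : Exponent
      p = ratio a b
      r = ratio c d

      Quotient : ℝ → Set
      Quotient t = ∃ λ (x : Vector ℝ n) → ¬ (∀ i → x i ≡ 0ℝ) × t ≡ ∥ apply A x ∥[ r ] ÷ ∥ x ∥[ p ]

    Bounded : ℝ → Set
    Bounded M = ∀ (x : Vector ℝ n) → ¬ (∀ i → x i ≡ 0ℝ) → ∥ apply A x ∥[ r ] ≤ M * ∥ x ∥[ p ]

    private
      -- The value of `sup` is specified only on bounded predicates.
      crudeBound : ℝ
      crudeBound = supNormFactor c d n * sum λ i → sum λ j → A i j

      crudeBounded : NonNegative A → Bounded crudeBound
      crudeBounded 0≤A x _ = subst (∥ apply A x ∥[ r ] ≤_)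
        (sym (*-assoc (supNormFactor c d n) (sum λ i → sum λ j → A i j) ∥ x ∥[ p ]))
        (norm≤ c d (apply A x) (*-nonNeg 0≤w 0≤∥x∥) λ i → begin
          abs (apply A x i)            ≤⟨ abs-apply-≤ 0≤A x i ⟩
          (sum λ j → A i j * abs (x j)) ≤⟨ sum-mono-≤ (λ j → *-monoʳ-≤ (0≤A i j) (abs≤norm a b x j)) ⟩
          (sum λ j → A i j * ∥ x ∥[ p ]) ≡⟨ *-distribʳ-sum ∥ x ∥[ p ] (A i) ⟨
          sum (A i) * ∥ x ∥[ p ]       ≤⟨ *-monoˡ-≤ 0≤∥x∥ (term≤sum 0≤row i) ⟩
          (sum λ i → sum λ j → A i j) * ∥ x ∥[ p ] ∎)
        where
        open ≤-Reasoning
        0≤∥x∥ = norm-nonNeg a b x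
        0≤row : ∀ i → 0ℝ ≤ sum (A i)
        0≤row i = sum-nonNeg (0≤A i)
        0≤w = sum-nonNeg 0≤row

      upperBound : ∀ {M} → Bounded M → ∀ t → Quotient t → t ≤ M
      upperBound {M} bounded _ (x , x≢0 , refl) =
        *-cancelʳ-≤ (norm-nonNeg a b x) (norm≢0 a b x≢0)
          (subst (_≤ M * ∥ x ∥[ p ]) (sym (÷-*-cancel _ (norm≢0 a b x≢0))) (bounded x x≢0))

      quotient≤opNorm : NonNegative A → ∀ t → Quotient t → t ≤ opNorm A p r
      quotient≤opNorm 0≤A t q = sup-upper Quotient (t , q) (_ , upperBound (crudeBounded 0≤A)) t q

      -- One explicit quotient supplies both the nonemptiness required by `sup-least` and the
      -- nonnegativity of the operator norm. A nonzero vector exists because n is positive.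
      onesQuotient : .{{NonZero n}} → ∃ λ t → 0ℝ ≤ t × Quotient t
      onesQuotient = _ , *-nonNeg (norm-nonNeg c d (apply A ones))
                       (⁻¹-nonNeg (norm-nonNeg a b ones) (norm≢0 a b ones≢0)) ,
        ones , ones≢0 , refl
        where
        ones : Vector ℝ n
        ones _ = 1ℝ
        ones≢0 : ¬ (∀ i → ones i ≡ 0ℝ)
        ones≢0 eq = 1≢0 (eq (vertex n))
          where
          vertex : ∀ n → .{{NonZero n}} → Fin n
          vertex (suc n) = zero

    norm≤opNorm : NonNegative A → Bounded (opNorm A p r)
    norm≤opNorm 0≤A x x≢0 =
      subst (_≤ opNorm A p r * ∥ x ∥[ p ]) (÷-*-cancel (∥ apply A x ∥[ r ]) (norm≢0 a b x≢0))
        (*-monoˡ-≤ (norm-nonNeg a b x) (quotient≤opNorm 0≤A _ (x , x≢0 , refl)))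

    opNorm-nonNeg : .{{NonZero n}} → NonNegative A → 0ℝ ≤ opNorm A p r
    opNorm-nonNeg 0≤A = let t , 0≤t , q = onesQuotient in
      ≤-trans 0≤t (quotient≤opNorm 0≤A t q)

    opNorm-least : ∀ {M} → .{{NonZero n}} → Bounded M → opNorm A p r ≤ M
    opNorm-least {M} bounded = let t , _ , q = onesQuotient in
      sup-least Quotient (t , q) M (upperBound bounded)

  -- Interpolation

  matrixSquare : ∀ {n} → Matrix n → Matrix n
  matrixSquare A i j = sum λ l → A i l * A l j

  form : ∀ {n} → Matrix n → Vector ℝ n → Vector ℝ n → ℝ
  form A u w = sum λ i → sum λ j → A i j * (u i * w j)

  module _ {n} {A : Matrix n} (A-sym : SymmetricMatrix A) where
    form-sym : ∀ u w → form A u w ≡ form A w u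
    form-sym u w = trans (∑-comm λ i j → A i j * (u i * w j))
      (sum-cong λ j → sum-cong λ i → cong₂ _*_ (A-sym i j) (*-comm (u i) (w j)))

    form≡Σapply : ∀ u w → form A u w ≡ sum λ j → apply A u j * w j
    form≡Σapply u w = trans (form-sym u w) (sum-cong λ j → trans
      (sum-cong λ i → solve 3 (λ a u w → a :* (w :* u) := a :* u :* w) refl (A j i) (u i) (w j))
      (sym (*-distribʳ-sum (w j) (λ i → A j i * u i))))

    apply-matrixSquare : ∀ (u : Vector ℝ n) i → apply (matrixSquare A) u i ≡ apply A (apply A u) i
    apply-matrixSquare u i = begin
      (sum λ j → (sum λ l → A i l * A l j) * u j)
        ≡⟨ sum-cong (λ j → *-distribʳ-sum (u j) (λ l → A i l * A l j)) ⟩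
      (sum λ j → sum λ l → A i l * A l j * u j)   ≡⟨ ∑-comm (λ j l → A i l * A l j * u j) ⟩
      (sum λ l → sum λ j → A i l * A l j * u j)
        ≡⟨ sum-cong (λ l → trans (sum-cong λ j → *-assoc (A i l) (A l j) (u j))
             (sym (*-distribˡ-sum (A i l) (λ j → A l j * u j)))) ⟩
      (sum λ l → A i l * sum λ j → A l j * u j)   ∎
      where open ≡-Reasoning

    Σapply² : ∀ (u : Vector ℝ n) →
      (sum λ j → apply A u j * apply A u j) ≡ sum λ i → u i * apply (matrixSquare A) u i
    Σapply² u = begin
      (sum λ j → apply A u j * apply A u j)   ≡⟨ form≡Σapply u (apply A u) ⟨
      form A u (apply A u)                    ≡⟨ form-sym u (apply A u) ⟩
      form A (apply A u) u                    ≡⟨ form≡Σapply (apply A u) u ⟩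
      (sum λ i → apply A (apply A u) i * u i)
        ≡⟨ sum-cong (λ i → trans (*-comm _ (u i)) (cong (u i *_) (sym (apply-matrixSquare u i)))) ⟩
      (sum λ i → u i * apply (matrixSquare A) u i) ∎
      where open ≡-Reasoning

    form² : ∀ {u w : Vector ℝ n} → form A u w * form A u w ≤
      sum (λ i → u i * apply (matrixSquare A) u i) * sum (λ j → w j * w j)
    form² {u} {w} = subst₂ (λ B Q → B * B ≤ Q * sum (λ j → w j * w j))
      (sym (form≡Σapply u w)) (Σapply² u)
      (GeometricBound.bound (geometricBound-sum λ j → geometricBound
        (square-nonNeg (apply A u j)) (square-nonNeg (w j))
        (≤-reflexive (solve 2 (λ v w → v :* w :* (v :* w) := v :* v :* (w :* w)) refl (apply A u j) (w j)))))

  matrixSquare-nonNeg : ∀ {n} {A : Matrix n} → NonNegative A → NonNegative (matrixSquare A)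
  matrixSquare-nonNeg 0≤A i j = sum-nonNeg λ l → *-nonNeg (0≤A i l) (0≤A l j)

  matrixSquare-sym : ∀ {n} {A : Matrix n} → SymmetricMatrix A → SymmetricMatrix (matrixSquare A)
  matrixSquare-sym {A = A} A-sym i j = sum-cong λ l →
    trans (cong₂ _*_ (A-sym i l) (A-sym l j)) (*-comm (A l i) (A j l))

  -- For k = v and m = 2e − v, the ratios N / m, N / k, 2N / (m + e) and
  -- 2N / (k + e) are the exponents s′, s, σ′ and σ.
  module Interpolation (m k e : ℕ) .{{_ : NonZero m}} .{{_ : NonZero k}} .{{_ : NonZero e}}
    (m+k≡e+e : m ℕ.+ k ≡ e ℕ.+ e) {n} {A : Matrix n}
    (0≤A : NonNegative A) (A-sym : SymmetricMatrix A) where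
    private
      N = m ℕ.+ k

      instance
        N≢0 : NonZero N
        N≢0 = +-nonZero m k

        N+N≢0 : NonZero (N ℕ.+ N)
        N+N≢0 = +-nonZero N N

        m+e≢0 : NonZero (m ℕ.+ e)
        m+e≢0 = +-nonZero m e

        k+e≢0 : NonZero (k ℕ.+ e)
        k+e≢0 = +-nonZero k e

      W = matrixSquare A
      module OpW = OpNorm W N m N k
      module OpA = OpNorm A (N ℕ.+ N) (m ℕ.+ e) (N ℕ.+ N) (k ℕ.+ e)

    module _ {K : ℝ} (0≤K : 0ℝ ≤ K) (W-bounded : OpW.Bounded K) where
      private
        module _ {a : Vector ℝ n} (0≤a : ∀ i → 0ℝ ≤ a i) (Σ≢0 : sum (λ i → a i ^ N) ≢ 0ℝ) where
          u : Vector ℝ n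
          u i = a i ^ m
          0≤u : ∀ i → 0ℝ ≤ u i
          0≤u i = ^-nonNeg m (0≤a i)
          0≤Wu : ∀ i → 0ℝ ≤ apply W u i
          0≤Wu = apply-nonNeg (matrixSquare-nonNeg 0≤A) 0≤u
          S Q : ℝ
          S = sum λ i → a i ^ N
          Q = sum λ i → u i * apply W u i
          0≤S : 0ℝ ≤ S
          0≤S = sum-nonNeg λ i → ^-nonNeg N (0≤a i)

          -- `Bounded` speaks of nonzero vectors only; this is the origin of the hypothesis `Σ≢0`.
          u≢0 : ¬ (∀ i → u i ≡ 0ℝ)
          u≢0 u≡0 = Σ≢0 (trans (sum-cong λ i → trans (^-homo-* (a i) m k)
            (trans (cong (_* a i ^ k) (u≡0 i)) (zeroˡ _))) (sum-zero n))
            where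
            sum-zero : ∀ n → sum {n} (λ _ → 0ℝ) ≡ 0ℝ
            sum-zero zero    = refl
            sum-zero (suc n) = trans (+-identityˡ _) (sum-zero n)

          -- Hölder applies because 1/s′ + 1/s = m/N + k/N = 1: u is the m-th power of `a`, and W u
          -- is the k-th power of `q`.
          Q-bound : Q ^ N ≤ S ^ m * (K ^ N * S ^ m)
          Q-bound = begin
            Q ^ N ≡⟨ cong (_^ N) (sum-cong λ i → cong (u i *_)
                       (trans (sym (0≤x⇒abs≡x (0≤Wu i))) (sym (absRoot-^ N k (apply W u) i)))) ⟩
            sum (λ i → a i ^ m * q i ^ k) ^ N
              ≤⟨ hölder 0≤a (absRoot-nonNeg N k (apply W u)) m k ⟩
            S ^ m * sum (λ i → q i ^ N) ^ k
              ≡⟨ cong (S ^ m *_) (norm-^ N k (absRoot-nonNeg N k (apply W u)) (absRoot-^ N k (apply W u))) ⟨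
            S ^ m * ∥ apply W u ∥[ ratio N k ] ^ N
              ≤⟨ *-monoʳ-≤ (^-nonNeg m 0≤S) (^-mono-≤ N (norm-nonNeg N k (apply W u)) (W-bounded u u≢0)) ⟩
            S ^ m * (K * ∥ u ∥[ ratio N m ]) ^ N
              ≡⟨ cong (S ^ m *_) (trans (^-distrib-* K ∥ u ∥[ ratio N m ] N)
                   (cong (K ^ N *_) (norm-^ N m 0≤a (λ i → sym (0≤x⇒abs≡x (0≤u i)))))) ⟩
            S ^ m * (K ^ N * S ^ m) ∎
            where
            open ≤-Reasoning
            q = absRoot N k (apply W u)

        -- The N-th power of ⟨u, A w⟩ ≤ √K ‖u‖_{s′} ‖w‖₂ for u = aᵐ and w = bᵉ. As N = 2e, the
        -- factor (√K)ᴺ is the integer power Kᵉ; the proof squares once more in order to use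
        -- `form²`.
        form-bound : ∀ {a b : Vector ℝ n} → (∀ i → 0ℝ ≤ a i) → (∀ j → 0ℝ ≤ b j) →
          sum (λ i → a i ^ N) ≢ 0ℝ →
          form A (λ i → a i ^ m) (λ j → b j ^ e) ^ N ≤
          sum (λ i → a i ^ N) ^ m * K ^ e * sum (λ j → b j ^ N) ^ e
        form-bound {a} {b} 0≤a 0≤b Σ≢0 = ^-cancel-≤ 2
          (*-nonNeg (*-nonNeg (^-nonNeg m (0≤S 0≤a Σ≢0)) (^-nonNeg e 0≤K))
            (^-nonNeg e (sum-nonNeg λ j → ^-nonNeg N (0≤b j)))) (begin
          (B ^ N) ^ 2           ≡⟨ ^-comm B N 2 ⟩
          (B ^ 2) ^ N           ≡⟨ cong (_^ N) (x^2≡x*x B) ⟩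
          (B * B) ^ N           ≤⟨ ^-mono-≤ N (square-nonNeg B) (form² A-sym) ⟩
          (Q 0≤a Σ≢0 * sum (λ j → b j ^ e * b j ^ e)) ^ N
                                ≡⟨ cong (λ T → (Q 0≤a Σ≢0 * T) ^ N) (sum-cong λ j →
                                     trans (sym (^-homo-* (b j) e e)) (cong (b j ^_) (sym m+k≡e+e))) ⟩
          (Q 0≤a Σ≢0 * T) ^ N   ≡⟨ ^-distrib-* (Q 0≤a Σ≢0) T N ⟩
          Q 0≤a Σ≢0 ^ N * T ^ N
            ≤⟨ *-monoˡ-≤ (^-nonNeg N (sum-nonNeg λ j → ^-nonNeg N (0≤b j))) (Q-bound 0≤a Σ≢0) ⟩
          Σa ^ m * (K ^ N * Σa ^ m) * T ^ N
                                ≡⟨ cong₂ (λ x y → Σa ^ m * (x * Σa ^ m) * y) (N≡e+e K) (N≡e+e T) ⟩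
          Σa ^ m * (K ^ e * K ^ e * Σa ^ m) * (T ^ e * T ^ e)
            ≡⟨ solve 3 (λ s k t → s :* (k :* k :* s) :* (t :* t) := s :* k :* t :* (s :* k :* t))
                                     refl (Σa ^ m) (K ^ e) (T ^ e) ⟩
          Σa ^ m * K ^ e * T ^ e * (Σa ^ m * K ^ e * T ^ e)
                                ≡⟨ x^2≡x*x _ ⟨
          (Σa ^ m * K ^ e * T ^ e) ^ 2 ∎)
          where
          open ≤-Reasoning
          B = form A (λ i → a i ^ m) (λ j → b j ^ e)
          Σa = sum λ i → a i ^ N
          T = sum λ j → b j ^ N
          N≡e+e : ∀ x → x ^ N ≡ x ^ e * x ^ e
          N≡e+e x = trans (cong (x ^_) m+k≡e+e) (^-homo-* x e e)

        module _ (x : Vector ℝ n) (x≢0 : ¬ (∀ i → x i ≡ 0ℝ)) where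
          -- The duality vector y = (A x)^{σ−1} is i ↦ z i ^ (m + e), because
          -- σ − 1 = (m + e) / (k + e).
          t z a b : Vector ℝ n
          t = absRoot (N ℕ.+ N) (m ℕ.+ e) x
          z = absRoot (N ℕ.+ N) (k ℕ.+ e) (apply A x)
          -- Squares, because Cauchy-Schwarz halves exponents: z^{m+e} is the geometric mean of aᵐ
          -- and aᵉ, and t^{m+e} that of bᵉ and bᵐ.
          a i = z i * z i
          b j = t j * t j
          0≤t : ∀ j → 0ℝ ≤ t j
          0≤t = absRoot-nonNeg (N ℕ.+ N) (m ℕ.+ e) x
          0≤z : ∀ i → 0ℝ ≤ z i
          0≤z = absRoot-nonNeg (N ℕ.+ N) (k ℕ.+ e) (apply A x)
          Σa Σb C : ℝ
          Σa = sum λ i → a i ^ N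
          Σb = sum λ j → b j ^ N
          C = form A (λ i → z i ^ (m ℕ.+ e)) (λ j → t j ^ (m ℕ.+ e))

          double : ∀ y → y ^ (N ℕ.+ N) ≡ (y * y) ^ N
          double y = trans (^-homo-* y N N) (sym (^-distrib-* y y N))

          norm-x : ∥ x ∥[ ratio (N ℕ.+ N) (m ℕ.+ e) ] ^ (N ℕ.+ N) ≡ Σb ^ (m ℕ.+ e)
          norm-x = trans (norm-^ (N ℕ.+ N) (m ℕ.+ e) 0≤t (absRoot-^ (N ℕ.+ N) (m ℕ.+ e) x))
            (cong (_^ (m ℕ.+ e)) (sum-cong (double ∘ t)))

          norm-Ax : ∥ apply A x ∥[ ratio (N ℕ.+ N) (k ℕ.+ e) ] ^ (N ℕ.+ N) ≡ Σa ^ (k ℕ.+ e)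
          norm-Ax = trans (norm-^ (N ℕ.+ N) (k ℕ.+ e) 0≤z (absRoot-^ (N ℕ.+ N) (k ℕ.+ e) (apply A x)))
            (cong (_^ (k ℕ.+ e)) (sum-cong (double ∘ z)))

          0≤Σa : 0ℝ ≤ Σa
          0≤Σa = sum-nonNeg λ i → ^-nonNeg N (square-nonNeg (z i))

          0≤Σb : 0ℝ ≤ Σb
          0≤Σb = sum-nonNeg λ j → ^-nonNeg N (square-nonNeg (t j))

          Σb≢0 : Σb ≢ 0ℝ
          Σb≢0 Σb≡0 = ^-≢0 (N ℕ.+ N) (norm≢0 (N ℕ.+ N) (m ℕ.+ e) x≢0)
            (trans norm-x (trans (cong (_^ (m ℕ.+ e)) Σb≡0) (0^n≡0 (m ℕ.+ e))))

          -- Since 2N = (m + e) + (k + e), each term on the left is yᵢ |(A x)ᵢ|. Nonnegativity of A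
          -- moves the absolute value onto x, and `t j ^ (m + e)` is |xⱼ|.
          Σa≤C : Σa ≤ C
          Σa≤C = sum-mono-≤ λ i → begin
            a i ^ N                               ≡⟨ double (z i) ⟨
            z i ^ (N ℕ.+ N)
              ≡⟨ cong (z i ^_) (trans (cong (N ℕ.+_) m+k≡e+e) (exponents m k e)) ⟩
            z i ^ (m ℕ.+ e ℕ.+ (k ℕ.+ e))         ≡⟨ ^-homo-* (z i) (m ℕ.+ e) (k ℕ.+ e) ⟩
            z i ^ (m ℕ.+ e) * z i ^ (k ℕ.+ e)
              ≡⟨ cong (z i ^ (m ℕ.+ e) *_) (absRoot-^ (N ℕ.+ N) (k ℕ.+ e) (apply A x) i) ⟩
            z i ^ (m ℕ.+ e) * abs (apply A x i)
              ≤⟨ *-monoʳ-≤ (^-nonNeg (m ℕ.+ e) (0≤z i)) (abs-apply-≤ 0≤A x i) ⟩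
            z i ^ (m ℕ.+ e) * sum (λ j → A i j * abs (x j))
              ≡⟨ *-distribˡ-sum (z i ^ (m ℕ.+ e)) (λ j → A i j * abs (x j)) ⟩
            sum (λ j → z i ^ (m ℕ.+ e) * (A i j * abs (x j)))
              ≡⟨ sum-cong (λ j → trans (solve 3 (λ z a x → z :* (a :* x) := a :* (z :* x)) refl
                   (z i ^ (m ℕ.+ e)) (A i j) (abs (x j)))
                   (cong (λ y → A i j * (z i ^ (m ℕ.+ e) * y)) (sym (absRoot-^ (N ℕ.+ N) (m ℕ.+ e) x j)))) ⟩
            sum (λ j → A i j * (z i ^ (m ℕ.+ e) * t j ^ (m ℕ.+ e))) ∎
            where
            open ≤-Reasoning
            exponents : ∀ m k e → m ℕ.+ k ℕ.+ (e ℕ.+ e) ≡ m ℕ.+ e ℕ.+ (k ℕ.+ e)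
            exponents = solve-∀

          C² : C * C ≤ form A (λ i → a i ^ m) (λ j → b j ^ e) * form A (λ i → a i ^ e) (λ j → b j ^ m)
          C² = GeometricBound.bound (geometricBound-sum λ i → geometricBound-sum λ j → geometricBound
            (*-nonNeg (0≤A i j) (*-nonNeg (^-nonNeg m (square-nonNeg (z i))) (^-nonNeg e (square-nonNeg (t j)))))
            (*-nonNeg (0≤A i j) (*-nonNeg (^-nonNeg e (square-nonNeg (z i))) (^-nonNeg m (square-nonNeg (t j)))))
            (≤-reflexive (begin
              A i j * (z i ^ (m ℕ.+ e) * t j ^ (m ℕ.+ e)) * (A i j * (z i ^ (m ℕ.+ e) * t j ^ (m ℕ.+ e)))
                ≡⟨ cong₂ (λ p q → A i j * (p * q) * (A i j * (p * q))) (^-homo-* (z i) m e) (^-homo-* (t j) m e) ⟩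
              A i j * (z i ^ m * z i ^ e * (t j ^ m * t j ^ e)) *
              (A i j * (z i ^ m * z i ^ e * (t j ^ m * t j ^ e)))
                ≡⟨ solve 5 (λ a p q r s → a :* (p :* q :* (r :* s)) :* (a :* (p :* q :* (r :* s))) :=
                     a :* (p :* p :* (s :* s)) :* (a :* (q :* q :* (r :* r)))) refl
                     (A i j) (z i ^ m) (z i ^ e) (t j ^ m) (t j ^ e) ⟩
              A i j * (z i ^ m * z i ^ m * (t j ^ e * t j ^ e)) *
              (A i j * (z i ^ e * z i ^ e * (t j ^ m * t j ^ m)))
                ≡⟨ cong₂ (λ p q → A i j * p * (A i j * q))
                     (cong₂ _*_ (sym (^-distrib-* (z i) (z i) m)) (sym (^-distrib-* (t j) (t j) e)))
                     (cong₂ _*_ (sym (^-distrib-* (z i) (z i) e)) (sym (^-distrib-* (t j) (t j) m))) ⟩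
              A i j * (a i ^ m * b j ^ e) * (A i j * (a i ^ e * b j ^ m)) ∎)))
            where open ≡-Reasoning

          -- `form-bound` for (a, b), and for (b, a) after transposing the second form, bounds (C²)ᴺ
          -- by Kᴺ times the (m + e)-th powers of Σa and Σb. As Σa ≤ C, the left side is at least
          -- Σa^{2N}; cancelling Σa^{m+e} leaves the exponent k + e.
          powerBound : Σa ^ (k ℕ.+ e) ≤ K ^ N * Σb ^ (m ℕ.+ e)
          powerBound with Σa ≟ℝ 0ℝ
          ... | yes Σa≡0 = subst (_≤ K ^ N * Σb ^ (m ℕ.+ e))
            (sym (trans (cong (_^ (k ℕ.+ e)) Σa≡0) (0^n≡0 (k ℕ.+ e))))
            (*-nonNeg (^-nonNeg N 0≤K) (^-nonNeg (m ℕ.+ e) 0≤Σb))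
          ... | no Σa≢0 = *-cancelʳ-≤ (^-nonNeg (m ℕ.+ e) 0≤Σa) (^-≢0 (m ℕ.+ e) Σa≢0) (begin
            Σa ^ (k ℕ.+ e) * Σa ^ (m ℕ.+ e)  ≡⟨ ^-homo-* Σa (k ℕ.+ e) (m ℕ.+ e) ⟨
            Σa ^ (k ℕ.+ e ℕ.+ (m ℕ.+ e))
              ≡⟨ cong (Σa ^_) (trans (exponents m k e) (cong (N ℕ.+_) (sym m+k≡e+e))) ⟩
            Σa ^ (N ℕ.+ N)                   ≡⟨ double Σa ⟩
            (Σa * Σa) ^ N
              ≤⟨ ^-mono-≤ N (square-nonNeg Σa) (*-mono-≤ 0≤Σa (≤-trans 0≤Σa Σa≤C) Σa≤C Σa≤C) ⟩
            (C * C) ^ N                      ≤⟨ ^-mono-≤ N (square-nonNeg C) C² ⟩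
            (B * B′) ^ N                     ≡⟨ ^-distrib-* B B′ N ⟩
            B ^ N * B′ ^ N
              ≡⟨ cong (λ y → B ^ N * y ^ N) (form-sym A-sym (λ i → a i ^ e) (λ j → b j ^ m)) ⟩
            B ^ N * B″ ^ N
              ≤⟨ *-mono-≤ (^-nonNeg N 0≤B)
                   (*-nonNeg (*-nonNeg (^-nonNeg m 0≤Σb) (^-nonNeg e 0≤K)) (^-nonNeg e 0≤Σa))
                   (form-bound (square-nonNeg ∘ z) (square-nonNeg ∘ t) Σa≢0)
                   (form-bound (square-nonNeg ∘ t) (square-nonNeg ∘ z) Σb≢0) ⟩
            Σa ^ m * K ^ e * Σb ^ e * (Σb ^ m * K ^ e * Σa ^ e)
              ≡⟨ solve 5 (λ p q r s k → p :* k :* q :* (r :* k :* s) := k :* k :* (r :* q) :* (p :* s)) refl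
                   (Σa ^ m) (Σb ^ e) (Σb ^ m) (Σa ^ e) (K ^ e) ⟩
            K ^ e * K ^ e * (Σb ^ m * Σb ^ e) * (Σa ^ m * Σa ^ e)
              ≡⟨ cong₂ _*_ (cong₂ _*_ (trans (sym (^-homo-* K e e)) (cong (K ^_) (sym m+k≡e+e)))
                   (sym (^-homo-* Σb m e))) (sym (^-homo-* Σa m e)) ⟩
            K ^ N * Σb ^ (m ℕ.+ e) * Σa ^ (m ℕ.+ e) ∎)
            where
            open ≤-Reasoning
            B = form A (λ i → a i ^ m) (λ j → b j ^ e)
            B′ = form A (λ i → a i ^ e) (λ j → b j ^ m)
            B″ = form A (λ j → b j ^ m) (λ i → a i ^ e)
            0≤B : 0ℝ ≤ B
            0≤B = sum-nonNeg λ i → sum-nonNeg λ j → *-nonNeg (0≤A i j)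
              (*-nonNeg (^-nonNeg m (square-nonNeg (z i))) (^-nonNeg e (square-nonNeg (t j))))
            exponents : ∀ m k e → k ℕ.+ e ℕ.+ (m ℕ.+ e) ≡ m ℕ.+ k ℕ.+ (e ℕ.+ e)
            exponents = solve-∀

      A-bounded : OpA.Bounded (root 2 K)
      A-bounded x x≢0 = ^-cancel-≤ (N ℕ.+ N)
        (*-nonNeg (root-nonNeg 2 0≤K) (norm-nonNeg (N ℕ.+ N) (m ℕ.+ e) x)) (begin
        ∥ apply A x ∥[ ratio (N ℕ.+ N) (k ℕ.+ e) ] ^ (N ℕ.+ N) ≡⟨ norm-Ax x x≢0 ⟩
        Σa x x≢0 ^ (k ℕ.+ e)                              ≤⟨ powerBound x x≢0 ⟩
        K ^ N * Σb x x≢0 ^ (m ℕ.+ e)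
          ≡⟨ cong₂ _*_ (trans (cong (_^ N) (trans (sym (root-^ 2 0≤K)) (x^2≡x*x (root 2 K))))
               (sym (double x x≢0 (root 2 K))))
               (sym (norm-x x x≢0)) ⟩
        root 2 K ^ (N ℕ.+ N) * ∥ x ∥[ ratio (N ℕ.+ N) (m ℕ.+ e) ] ^ (N ℕ.+ N)
          ≡⟨ ^-distrib-* (root 2 K) ∥ x ∥[ ratio (N ℕ.+ N) (m ℕ.+ e) ] (N ℕ.+ N) ⟨
        (root 2 K * ∥ x ∥[ ratio (N ℕ.+ N) (m ℕ.+ e) ]) ^ (N ℕ.+ N) ∎)
        where open ≤-Reasoning

    opNorm²≤opNorm-matrixSquare : .{{NonZero n}} →
      opNorm A (ratio (N ℕ.+ N) (m ℕ.+ e)) (ratio (N ℕ.+ N) (k ℕ.+ e)) ^ 2 ≤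
      opNorm W (ratio N m) (ratio N k)
    opNorm²≤opNorm-matrixSquare = subst (OPA ^ 2 ≤_) (root-^ 2 0≤OPW)
      (^-mono-≤ 2 (OpA.opNorm-nonNeg 0≤A) (OpA.opNorm-least (A-bounded 0≤OPW (OpW.norm≤opNorm 0≤W))))
      where
      OPA = opNorm A (ratio (N ℕ.+ N) (m ℕ.+ e)) (ratio (N ℕ.+ N) (k ℕ.+ e))
      OPW = opNorm W (ratio N m) (ratio N k)
      0≤W = matrixSquare-nonNeg 0≤A
      0≤OPW : 0ℝ ≤ OPW
      0≤OPW = OpW.opNorm-nonNeg 0≤W

  open SumSplit (Semiring.+-monoid semiring)
  open Algebra.Properties.Monoid.Mult (Semiring.+-monoid semiring) using (×-homo-+)

  -- Homomorphisms from the subdivision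

  indicator : Bool → ℝ
  indicator b = if b then 1ℝ else 0ℝ

  fromℕ-sum : ∀ {n} (f : Fin n → ℕ) → fromℕ (ℕΣ.sum f) ≡ sum (fromℕ ∘ f)
  fromℕ-sum {zero}  f = refl
  fromℕ-sum {suc n} f = trans (×-homo-+ 1ℝ (f zero) (ℕΣ.sum (f ∘ suc)))
    (cong (fromℕ (f zero) +_) (fromℕ-sum (f ∘ suc)))

  fromℕ-𝟙 : ∀ b → fromℕ (𝟙 b) ≡ indicator b
  fromℕ-𝟙 true  = +-identityʳ 1ℝ
  fromℕ-𝟙 false = refl

  product-cong : ∀ {n} {f g : Vector ℝ n} → f ≗ g → product f ≡ product g
  product-cong {zero}  f≗g = refl
  product-cong {suc n} f≗g = cong₂ _*_ (f≗g zero) (product-cong (f≗g ∘ suc))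

  product-ones : ∀ {n} {f : Vector ℝ n} → (∀ i → f i ≡ 1ℝ) → product f ≡ 1ℝ
  product-ones {zero}  f≡1 = refl
  product-ones {suc n} f≡1 = trans (cong₂ _*_ (f≡1 zero) (product-ones (f≡1 ∘ suc))) (*-identityˡ 1ℝ)

  product-zero : ∀ {n} {f : Vector ℝ n} i → f i ≡ 0ℝ → product f ≡ 0ℝ
  product-zero {f = f} zero    fi≡0 = trans (cong (_* product (f ∘ suc)) fi≡0) (zeroˡ (product (f ∘ suc)))
  product-zero {f = f} (suc i) fi≡0 = trans (cong (f zero *_) (product-zero i fi≡0)) (zeroʳ (f zero))

  -- The equivalence is a parameter because being a homomorphism of `sub H` quantifies over pairs of
  -- its vertices, whereas the product must run over the edges of H.
  indicator-∀ : ∀ {n} {P : Fin n → Set} {D : Set} (P? : ∀ i → Dec (P i)) (d : Dec D) →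
                D ⇔ (∀ i → P i) → indicator (does d) ≡ product λ i → indicator (does (P? i))
  indicator-∀ {n} {P} P? d D⇔∀P =
    trans (cong indicator (does-⇔ D⇔∀P d (all? P?))) (indicator-all (all? P?))
    where
    indicator-all : (d : Dec (∀ i → P i)) → indicator (does d) ≡ product λ i → indicator (does (P? i))
    indicator-all (yes ∀P) = sym (product-ones λ i → cong indicator (dec-true (P? i) (∀P i)))
    indicator-all (no ¬∀P) with i , ¬Pi ← ¬∀⟶∃¬ n P P? ¬∀P =
      sym (product-zero i (cong indicator (dec-false (P? i) ¬Pi)))

  indicator-× : ∀ {A B : Set} (a : Dec A) (b : Dec B) →
                indicator (does (a ×-dec b)) ≡ indicator (does a) * indicator (does b)
  indicator-× a b with does a
  ... | true  = sym (*-identityˡ _)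
  ... | false = sym (zeroˡ _)

  append : ∀ {n} k l → (Fin k → Fin n) → (Fin l → Fin n) → Fin (k ℕ.+ l) → Fin n
  append k l φ ψ i = [ φ , ψ ] (splitAt k i)

  -- Decoding with `finToFun` matches `_∷_` and `append` only pointwise, so sums over encoded maps
  -- are rearranged for summands that respect `_≗_`.
  Extensional : ∀ {n k} → ((Fin k → Fin n) → ℝ) → Set
  Extensional F = ∀ {f g} → f ≗ g → F f ≡ F g

  ∷-cong : ∀ {n k} (i : Fin n) {f g : Fin k → Fin n} → f ≗ g → i ∷ f ≗ i ∷ g
  ∷-cong i f≗g zero    = refl
  ∷-cong i f≗g (suc j) = f≗g j

  append-congˡ : ∀ {n} k l {f g : Fin k → Fin n} (h : Fin l → Fin n) →
                 f ≗ g → append k l f h ≗ append k l g h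
  append-congˡ k l h f≗g j with splitAt k j
  ... | inj₁ i = f≗g i
  ... | inj₂ _ = refl

  ∷-append : ∀ {n} k l (i : Fin n) (f : Fin k → Fin n) (h : Fin l → Fin n) →
             i ∷ append k l f h ≗ append (suc k) l (i ∷ f) h
  ∷-append k l i f h zero    = refl
  ∷-append k l i f h (suc j) with splitAt k j
  ... | inj₁ _ = refl
  ... | inj₂ _ = refl

  sum-finToFun-suc : ∀ {n} k {F : (Fin (suc k) → Fin n) → ℝ} → Extensional F →
    sum {n ℕ.^ suc k} (F ∘ finToFun) ≡ sum λ i → sum {n ℕ.^ k} λ c → F (i ∷ finToFun c)
  sum-finToFun-suc {n} k {F} ext = trans (sum-combine n (F ∘ finToFun))
    (sum-cong λ i → sum-cong λ c → ext (finToFun-combine i c))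

  -- This separates the images of the vertices of H from those of the subdividing vertices. The
  -- induction peels off the value at `zero`, which is the leading digit of the code.
  sum-finToFun-append : ∀ {n} k l {F : (Fin (k ℕ.+ l) → Fin n) → ℝ} → Extensional F →
    sum {n ℕ.^ (k ℕ.+ l)} (F ∘ finToFun) ≡
    sum {n ℕ.^ k} λ c → sum {n ℕ.^ l} λ d → F (append k l (finToFun c) (finToFun d))
  sum-finToFun-append {n} zero l {F} ext = trans (sum-cong {n ℕ.^ l} λ c → ext λ _ → refl)
    (sym (+-identityʳ _))
  sum-finToFun-append {n} (suc k) l {F} ext = begin
    sum (F ∘ finToFun)
      ≡⟨ sum-finToFun-suc (k ℕ.+ l) {F} ext ⟩
    sum (λ i → sum {n ℕ.^ (k ℕ.+ l)} λ c → F (i ∷ finToFun c))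
      ≡⟨ sum-cong (λ i → sum-finToFun-append k l {λ f → F (i ∷ f)} (λ f≗g → ext (∷-cong i f≗g))) ⟩
    sum (λ i → sum {n ℕ.^ k} λ c → sum {n ℕ.^ l} λ d → F (i ∷ append k l (finToFun c) (finToFun d)))
      ≡⟨ sum-cong (λ i → sum-cong λ c → sum-cong λ d → ext (∷-append k l i (finToFun c) (finToFun d))) ⟩
    sum (λ i → sum {n ℕ.^ k} λ c → sum {n ℕ.^ l} λ d → F (append (suc k) l (i ∷ finToFun c) (finToFun d)))
      ≡⟨ sum-finToFun-suc k {λ f → sum {n ℕ.^ l} λ d → F (append (suc k) l f (finToFun d))}
           (λ f≗g → sum-cong λ d → ext (append-congˡ (suc k) l (finToFun d) f≗g)) ⟨
    sum {n ℕ.^ suc k} (λ c → sum {n ℕ.^ l} λ d → F (append (suc k) l (finToFun c) (finToFun d))) ∎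
    where open ≡-Reasoning

  -- Expanding the product by distributivity: once the images of the vertices of H are fixed, those
  -- of the subdividing vertices are chosen independently.
  product-sum : ∀ {n} k (g : Fin k → Fin n → ℝ) →
    (sum {n ℕ.^ k} λ d → product λ j → g j (finToFun d j)) ≡ product λ j → sum (g j)
  product-sum         zero    g = +-identityʳ 1ℝ
  product-sum {n} (suc k) g = begin
    sum {n ℕ.^ suc k} (λ d → product λ j → g j (finToFun d j))
      ≡⟨ sum-finToFun-suc k {λ f → product λ j → g j (f j)} (λ f≗g → product-cong λ j → cong (g j) (f≗g j)) ⟩
    sum (λ i → sum {n ℕ.^ k} λ d → g zero i * product λ j → g (suc j) (finToFun d j))
      ≡⟨ sum-cong (λ i → *-distribˡ-sum {n ℕ.^ k} (g zero i) (λ d → product λ j → g (suc j) (finToFun d j))) ⟨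
    sum (λ i → g zero i * sum {n ℕ.^ k} λ d → product λ j → g (suc j) (finToFun d j))
      ≡⟨ *-distribʳ-sum _ (g zero) ⟨
    sum (g zero) * sum {n ℕ.^ k} (λ d → product λ j → g (suc j) (finToFun d j))
      ≡⟨ cong (sum (g zero) *_) (product-sum k (g ∘ suc)) ⟩
    product (λ j → sum (g j)) ∎
    where open ≡-Reasoning

  adjacency-nonNeg : ∀ G → NonNegative (adjacency G)
  adjacency-nonNeg G i j with does (Adj? G i j)
  ... | true  = 0≤1
  ... | false = ≤-refl

  adjacency-sym : ∀ G → SymmetricMatrix (adjacency G)
  adjacency-sym G i j = cong indicator
    (does-⇔ (mk⇔ (symmetric G) (symmetric G)) (Adj? G i j) (Adj? G j i))

  module _ (H G : Graph) where
    open Subdivision H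
    private
      v = order H
      e = size H
      n = order G

      HomSub : (Fin (v ℕ.+ e) → Fin n) → Set
      HomSub = IsHom (sub H) G

      -- Oriented from the first endpoint to the second, so that its indicator is a term of the
      -- corresponding entry of `matrixSquare`. The relation `Incident` has no such orientation;
      -- symmetry of G reconciles the two.
      Path : (Fin v → Fin n) → (Fin e → Fin n) → Fin e → Set
      Path φ ψ k = Adj G (φ (proj₁ (endpoints H k))) (ψ k) × Adj G (ψ k) (φ (proj₂ (endpoints H k)))

      path? : ∀ φ ψ k → Dec (Path φ ψ k)
      path? φ ψ k = Adj? G (φ (proj₁ (endpoints H k))) (ψ k) ×-dec Adj? G (ψ k) (φ (proj₂ (endpoints H k)))

      homSub⇔paths : ∀ φ ψ → HomSub (append v e φ ψ) ⇔ (∀ k → Path φ ψ k)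
      homSub⇔paths φ ψ = mk⇔ to from
        where
        toEdge : HomSub (append v e φ ψ) → ∀ u k → u endpointOf k → Adj G (φ u) (ψ k)
        toEdge hom u k inc = subst₂ (λ x y → Adj G ([ φ , ψ ] x) ([ φ , ψ ] y))
          (splitAt-↑ˡ v u e) (splitAt-↑ʳ v e k) (hom (u ↑ˡ e) (v ↑ʳ k)
            (subst₂ Incident (sym (splitAt-↑ˡ v u e)) (sym (splitAt-↑ʳ v e k)) inc))

        to : HomSub (append v e φ ψ) → ∀ k → Path φ ψ k
        to hom k = toEdge hom _ k (inj₁ refl) , symmetric G (toEdge hom _ k (inj₂ refl))

        fromEdge : (∀ k → Path φ ψ k) → ∀ u k → u endpointOf k → Adj G (φ u) (ψ k)
        fromEdge paths _ k (inj₁ refl) = proj₁ (paths k)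
        fromEdge paths _ k (inj₂ refl) = symmetric G (proj₂ (paths k))

        fromNode : (∀ k → Path φ ψ k) → ∀ x y → Incident x y → Adj G ([ φ , ψ ] x) ([ φ , ψ ] y)
        fromNode paths (inj₁ u) (inj₂ k) inc = fromEdge paths u k inc
        fromNode paths (inj₂ k) (inj₁ u) inc = symmetric G (fromEdge paths u k inc)

        from : (∀ k → Path φ ψ k) → HomSub (append v e φ ψ)
        from paths i j = fromNode paths (splitAt v i) (splitAt v j)

      count : (Fin (v ℕ.+ e) → Fin n) → ℝ
      count φ = indicator (does (isHom? (sub H) G φ))

      count-ext : Extensional count
      count-ext {f} {g} f≗g = cong indicator (does-⇔ (mk⇔
        (λ hom i j adj → subst₂ (Adj G) (f≗g i) (f≗g j) (hom i j adj))
        (λ hom i j adj → subst₂ (Adj G) (sym (f≗g i)) (sym (f≗g j)) (hom i j adj)))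
        (isHom? (sub H) G f) (isHom? (sub H) G g))

      walk : (Fin v → Fin n) → Fin e → Fin n → ℝ
      walk φ k l = adjacency G (φ (proj₁ (endpoints H k))) l * adjacency G l (φ (proj₂ (endpoints H k)))

      count-append : ∀ φ ψ → count (append v e φ ψ) ≡ product λ k → walk φ k (ψ k)
      count-append φ ψ = trans
        (indicator-∀ (path? φ ψ) (isHom? (sub H) G (append v e φ ψ)) (homSub⇔paths φ ψ))
        (product-cong λ k → indicator-× (Adj? G (φ (proj₁ (endpoints H k))) (ψ k))
                                        (Adj? G (ψ k) (φ (proj₂ (endpoints H k)))))

    hom-sub : fromℕ (hom (sub H) G) ≡ homW H (matrixSquare (adjacency G))
    hom-sub = begin
      fromℕ (hom (sub H) G)
        ≡⟨ cong fromℕ (length-filter-tabulate (isHom? (sub H) G ∘ finToFun) {n ℕ.^ (v ℕ.+ e)} id) ⟩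
      fromℕ (ℕΣ.sum {n ℕ.^ (v ℕ.+ e)} λ c → 𝟙 (does (isHom? (sub H) G (finToFun c))))
        ≡⟨ fromℕ-sum {n ℕ.^ (v ℕ.+ e)} (λ c → 𝟙 (does (isHom? (sub H) G (finToFun c)))) ⟩
      sum {n ℕ.^ (v ℕ.+ e)} (λ c → fromℕ (𝟙 (does (isHom? (sub H) G (finToFun c)))))
        ≡⟨ sum-cong {n ℕ.^ (v ℕ.+ e)} (λ c → fromℕ-𝟙 (does (isHom? (sub H) G (finToFun c)))) ⟩
      sum {n ℕ.^ (v ℕ.+ e)} (count ∘ finToFun)
        ≡⟨ sum-finToFun-append v e {count} count-ext ⟩
      sum {n ℕ.^ v} (λ c → sum {n ℕ.^ e} λ d → count (append v e (finToFun c) (finToFun d)))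
        ≡⟨ sum-cong {n ℕ.^ v} (λ c → sum-cong {n ℕ.^ e} λ d → count-append (finToFun c) (finToFun d)) ⟩
      sum {n ℕ.^ v} (λ c → sum {n ℕ.^ e} λ d → product λ k → walk (finToFun c) k (finToFun d k))
        ≡⟨ sum-cong {n ℕ.^ v} (λ c → product-sum e (walk (finToFun c))) ⟩
      homW H (matrixSquare (adjacency G)) ∎
      where open ≡-Reasoning

  -- The exponents of H and of its subdivision

  module _ (H : Graph) (v≤e : order H ℕ.≤ size H)
    (hom-bound : ∀ (n : ℕ) .{{_ : NonZero n}} (W : Matrix n) →
        NonNegative W → SymmetricMatrix W →
        opNorm W (s′ (order H) (size H) v≤e) (s (order H) (size H) v≤e) ^ size H
          ≤ homW H W) where
    private
      v = order H
      e = size H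
      m = 2 ℕ.* e ∸ v
      -- This is 2e, but written in the shape that the interpolation produces; since `m` is a
      -- truncated difference, the two agree only by a proof that uses v ≤ 2e.
      N = m ℕ.+ v

      v≤2e : v ℕ.≤ 2 ℕ.* e
      v≤2e = ℕ.≤-trans v≤e (ℕ.m≤m+n e (e ℕ.+ 0))

      N≡2e : N ≡ 2 ℕ.* e
      N≡2e = ℕ.m∸n+n≡m v≤2e

      2N≡4e : N ℕ.+ N ≡ 4 ℕ.* e
      2N≡4e = trans (cong₂ ℕ._+_ N≡2e N≡2e) (2e+2e≡4e e)
        where
        2e+2e≡4e : ∀ e → 2 ℕ.* e ℕ.+ 2 ℕ.* e ≡ 4 ℕ.* e
        2e+2e≡4e = solve-∀

      m+e≡3e∸v : m ℕ.+ e ≡ 3 ℕ.* e ∸ v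
      m+e≡3e∸v = trans (sym (ℕ.+-∸-comm e v≤2e)) (cong (_∸ v) (ℕ.+-comm (2 ℕ.* e) e))

      0<v : 0 ℕ.< v
      0<v = ℕ.>-nonZero⁻¹ v

      0<e : 0 ℕ.< e
      0<e = ℕ.<-≤-trans 0<v v≤e

      instance
        e≢0 : NonZero e
        e≢0 = ℕ.>-nonZero 0<e

        m≢0 : NonZero m
        m≢0 = ℕ.>-nonZero (ℕ.m<n⇒0<n∸m (ℕ.<-≤-trans (ℕ.≤-<-trans v≤e (ℕ.m<m+n e 0<e))
          (ℕ.+-monoʳ-≤ e (ℕ.m≤m+n e 0))))

        v≢0 : NonZero v
        v≢0 = order≢0 H

        N≢0 : NonZero N
        N≢0 = +-nonZero m v

        N+N≢0 : NonZero (N ℕ.+ N)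
        N+N≢0 = +-nonZero N N

        m+e≢0 : NonZero (m ℕ.+ e)
        m+e≢0 = +-nonZero m e

        v+e≢0 : NonZero (v ℕ.+ e)
        v+e≢0 = +-nonZero v e

      s′≡ : ratio N m ≡ s′ v e v≤e
      s′≡ = ratio-cong N≡2e refl

      s≡ : ratio N v ≡ s v e v≤e
      s≡ = ratio-cong N≡2e refl

      σ′≡ : ratio (N ℕ.+ N) (m ℕ.+ e) ≡ σ′ v e v≤e
      σ′≡ = ratio-cong 2N≡4e m+e≡3e∸v

      σ≡ : ratio (N ℕ.+ N) (v ℕ.+ e) ≡ σ v e v≤e
      σ≡ = ratio-cong 2N≡4e refl

      -- Both conclusions are transported from this form, whose exponents are neither those of `σ`
      -- nor those of the certificate by definition.
      opNorm-square-bound : ∀ (G : Graph) →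
        opNorm (adjacency G) (ratio (N ℕ.+ N) (m ℕ.+ e)) (ratio (N ℕ.+ N) (v ℕ.+ e)) ^ (2 ℕ.* e)
          ≤ fromℕ (hom (sub H) G)
      opNorm-square-bound G = begin
        X ^ (2 ℕ.* e)   ≡⟨ ^-assocʳ X 2 e ⟨
        (X ^ 2) ^ e     ≤⟨ ^-mono-≤ e (^-nonNeg 2 (O.opNorm-nonNeg {{order≢0 G}} (adjacency-nonNeg G)))
                               (I.opNorm²≤opNorm-matrixSquare {{order≢0 G}}) ⟩
        opNorm W (ratio N m) (ratio N v) ^ e
          ≡⟨ cong₂ (λ p r → opNorm W p r ^ e) s′≡ s≡ ⟩
        opNorm W (s′ v e v≤e) (s v e v≤e) ^ e
          ≤⟨ hom-bound (order G) {{order≢0 G}} W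
               (matrixSquare-nonNeg (adjacency-nonNeg G))
               (matrixSquare-sym (adjacency-sym G)) ⟩
        homW H W          ≡⟨ hom-sub H G ⟨
        fromℕ (hom (sub H) G) ∎
        where
        open ≤-Reasoning
        W = matrixSquare (adjacency G)
        module O = OpNorm (adjacency G) (N ℕ.+ N) (m ℕ.+ e) (N ℕ.+ N) (v ℕ.+ e)
          {{N+N≢0}} {{m+e≢0}} {{N+N≢0}} {{v+e≢0}}
        module I = Interpolation m v e (trans N≡2e (cong (e ℕ.+_) (ℕ.+-identityʳ e)))
          (adjacency-nonNeg G) (adjacency-sym G)
        X = opNorm (adjacency G) (ratio (N ℕ.+ N) (m ℕ.+ e)) (ratio (N ℕ.+ N) (v ℕ.+ e))

    opNorm-σ-bound : (G : Graph) →
      opNorm (adjacency G) (σ′ v e v≤e) (σ v e v≤e) ^ (2 ℕ.* e) ≤ fromℕ (hom (sub H) G)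
    opNorm-σ-bound G = subst₂ (λ p r → opNorm (adjacency G) p r ^ (2 ℕ.* e) ≤ fromℕ (hom (sub H) G))
      σ′≡ σ≡ (opNorm-square-bound G)

    sub-v≤e : order (sub H) ℕ.≤ size (sub H)
    sub-v≤e = subst (v ℕ.+ e ℕ.≤_) (sym (size-sub H))
      (ℕ.+-mono-≤ v≤e (ℕ.≤-reflexive (sym (ℕ.+-identityʳ e))))

    -- With v + e vertices and 2e edges, the certificate exponents of `sub H` are 4e / (v + e) and
    -- 4e / (4e - (v + e)), that is, σ and σ′.
    certificate-sub : Certificate (sub H)
    certificate-sub = sub-bipartite H , sub-v≤e , λ G →
      subst₂ (λ p r → opNorm (adjacency G) p r ^ size (sub H) ≤ fromℕ (hom (sub H) G))
        sub-s′≡ sub-s≡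
        (subst (λ n → opNorm (adjacency G) (ratio (N ℕ.+ N) (m ℕ.+ e)) (ratio (N ℕ.+ N) (v ℕ.+ e)) ^ n
                  ≤ fromℕ (hom (sub H) G)) (sym (size-sub H)) (opNorm-square-bound G))
      where
      2N≡ : N ℕ.+ N ≡ 2 ℕ.* size (sub H)
      2N≡ = trans 2N≡4e (trans (ℕ.*-assoc 2 2 e) (cong (2 ℕ.*_) (sym (size-sub H))))
      m+e≡ : m ℕ.+ e ≡ 2 ℕ.* size (sub H) ∸ (v ℕ.+ e)
      m+e≡ = begin
        m ℕ.+ e                        ≡⟨ ℕ.m+n∸n≡m (m ℕ.+ e) (v ℕ.+ e) ⟨
        m ℕ.+ e ℕ.+ (v ℕ.+ e) ∸ (v ℕ.+ e) ≡⟨ cong (_∸ (v ℕ.+ e)) (trans (regroup m v e)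
                                              (trans (cong (N ℕ.+_) (sym N≡2e)) 2N≡)) ⟩
        2 ℕ.* size (sub H) ∸ (v ℕ.+ e) ∎
        where
        open ≡-Reasoning
        regroup : ∀ m v e → m ℕ.+ e ℕ.+ (v ℕ.+ e) ≡ m ℕ.+ v ℕ.+ 2 ℕ.* e
        regroup = solve-∀
      sub-s′≡ : ratio (N ℕ.+ N) (m ℕ.+ e) ≡ s′ (v ℕ.+ e) (size (sub H)) {{order≢0 (sub H)}} sub-v≤e
      sub-s′≡ = ratio-cong 2N≡ m+e≡
      sub-s≡ : ratio (N ℕ.+ N) (v ℕ.+ e) ≡ s (v ℕ.+ e) (size (sub H)) {{order≢0 (sub H)}} sub-v≤e
      sub-s≡ = ratio-cong 2N≡ refl

open Reals {{...}}

proposition2p5 : {{R : Reals}} (H : Graph) → Bipartite H →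
    (v≤e : order H ℕ.≤ size H) →
    (∀ (n : ℕ) .{{_ : NonZero n}} (W : Matrix n) →
    NonNegative W → SymmetricMatrix W →
    opNorm W (s′ (order H) (size H) v≤e) (s (order H) (size H) v≤e) ^ size H
    ≤ homW H W) →
    Certificate (sub H) ×
    ((G : Graph) →
    opNorm (adjacency G) (σ′ (order H) (size H) v≤e) (σ (order H) (size H) v≤e)
    ^ (2 ℕ.* size H)
    ≤ fromℕ (hom (sub H) G))
proposition2p5 H _ v≤e hom-bound =
  certificate-sub H v≤e hom-bound , opNorm-σ-bound H v≤e hom-bound
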